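{- Let $r,p,s,n$ be positive integers such that $p\mid r$, $s\mid r$ and $ps\mid rn$. Then, as formal power series in $t,q$, $$\bigg\{\sum_{k\geq 0}t^k[k+1]^n_q\bigg\}_{q^p}=\frac{\sum_{g\in G(r,p,s,n)}t^{\mathrm{fdes}(g)}q^{\mathrm{fmaj}(g)}}{(1-t)(1-t^rq^r)(1-t^rq^{2r})\cdots(1-t^rq^{(n-1)r})(1-t^{\frac{r}{s}}q^{\frac{nr}{s}})}.$$
   Context: Notation. For a positive integer $m$, $R_m(i)\in\{0,\ldots,m-1\}$ denotes the residue of $i\in\mathbb Z$ modulo $m$. $[m]_x=1+x+\cdots+x^{m-1}$. For a power series $F$, $\{F\}_{q^p}$ is obtained from $F$ by discarding all terms whose degree in $q$ is not divisible by $p$. Groups. $G(r,n)$ is the group of pairs $(c_1,\ldots,c_n;\sigma)$ with $c_i\in\{0,\ldots,r-1\}$ (the colors) and $\sigma\in S_n$, with product $(d_1,\ldots,d_n;\tau)(c_1,\ldots,c_n;\sigma)=(R_r(c_1+d_{\sigma(1)}),\ldots,R_r(c_n+d_{\sigma(n)});\tau\sigma)$. For $p\mid r$, $G(r,p,n)$ is the subgroup of elements with $c_1+\cdots+c_n\equiv 0 \bmod p$. For $s\mid r$ with $ps\mid rn$, $C_s\subseteq G(r,p,n)$ is the cyclic subgroup of order $s$ generated by $(r/s,\ldots,r/s;\mathrm{id})$, and $G(r,p,s,n)=G(r,p,n)/C_s$. Statistics. For $g\in G(r,p,s,n)$ represented by $(c_1,\ldots,c_n;\sigma)$ let $\mathrm{HDes}(g)=\{i\in\{1,\ldots,n-1\}: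 c_i=c_{i+1},\ \sigma(i)>\sigma(i+1)\}$, $h_i(g)=\#\{j\ge i: j\in\mathrm{HDes}(g)\}$, $k_n(g)=R_{r/s}(c_n)$, $k_i(g)=k_{i+1}(g)+R_r(c_i-c_{i+1})$ for $1\le i\le n-1$, $\lambda_i(g)=r\,h_i(g)+k_i(g)$. Then $\mathrm{fmaj}(g)=\sum_{i=1}^n\lambda_i(g)$ and $\mathrm{fdes}(g)=\lambda_1(g)$. These do not depend on the representative chosen. -}

module Defs where

open import Algebra.Bundles using (Group)
open import Algebra.Bundles.Raw using (RawRing)
import Algebra.Definitions.RawMonoid as RawMonoidDefs
import Algebra.Definitions.RawSemiring as RawSemiringDefs
import Algebra.Properties.Monoid.Mult as Mult
open import Data.Bool.Base using (if_then_else_)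
open import Data.Fin.Base as Fin using (Fin; zero; suc; toℕ; fromℕ<; inject₁; funToFin; finToFun)
open import Data.Fin.Permutation as Perm using (Permutation′; _⟨$⟩ʳ_; _⟨$⟩ˡ_; _∘ₚ_; permutation)
open import Data.Fin.Properties as Finₚ
  using (toℕ-fromℕ<; toℕ-injective; toℕ<n; finToFun-funToFin; all?; any?)
open import Data.Integer.Base as ℤ using (ℤ; 0ℤ)
open import Data.Integer.DivMod using (_%ℕ_)
open import Data.List.Base as List using (List; length; filter; allFin; foldr; cartesianProduct; deduplicate)
open import Data.List.Membership.Propositional.Properties using (∈-allFin; ∈-cartesianProduct⁺)
open import Data.List.Relation.Unary.Any.Properties as Any using ()
import Data.List.Relation.Unary.Any as Any
open import Data.List.Relation.Unary.Enumerates.Setoid using (IsEnumeration)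
import Data.List.Relation.Unary.Enumerates.Setoid.Properties as Enumerates
open import Data.List.Relation.Unary.Unique.Setoid using (Unique)
import Data.List.Relation.Unary.Unique.DecSetoid.Properties as UniqueDec
open import Data.Nat.Base as ℕ using (ℕ; zero; suc; NonZero)
open import Data.Nat.Divisibility using (_∣_; _∣?_; quotient; quotient≢0; _∣0; m∣n⇒n≡m*quotient)
open import Data.Nat.DivMod
  using (_%_; _/_; m%n<n; m<n⇒m%n≡m; m≡m%n+[m/n]*n; %-distribˡ-+; n%n≡0; m*n%n≡0; _mod_)
import Data.Nat.Properties as ℕₚ
open import Data.Product.Base using (Σ; ∃; _×_; _,_; proj₁; proj₂)
open import Function.Base using (_∘_)
open import Level using (0ℓ)
open import Relation.Binary.Bundles using (Setoid; DecSetoid)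
open import Relation.Binary.PropositionalEquality
  using (_≡_; refl; sym; trans; cong; cong₂; module ≡-Reasoning)
import Relation.Binary.Reasoning.Setoid as SetoidReasoning
open import Relation.Nullary using (Dec; yes; no; does; contradiction)
open import Relation.Nullary.Decidable using (map′; _×-dec_)

-- The ring R⟦X⟧: a series is its coefficient function.
PowerSeries : ∀ {a ℓ} → RawRing a ℓ → RawRing a ℓ
PowerSeries R = record
  { Carrier = ℕ → Carrier
  ; _≈_     = λ f g → ∀ k → f k ≈ g k
  ; _+_     = λ f g k → f k + g k
  ; _*_     = λ f g k → sum {suc k} λ i → f (toℕ i) * g (k ℕ.∸ toℕ i)
  ; -_      = λ f k → - f k
  ; 0#      = λ _ → 0#
  ; 1#      = λ { zero → 1# ; (suc _) → 0# }
  }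
  where
  open RawRing R
  open RawSemiringDefs (RawRing.rawSemiring R) using (sum)

module _ {a ℓ} (R : RawRing a ℓ) where
  open RawRing R

  constant : Carrier → RawRing.Carrier (PowerSeries R)
  constant c zero    = c
  constant c (suc _) = 0#

  variable-X : RawRing.Carrier (PowerSeries R)
  variable-X (suc zero) = 1#
  variable-X _          = 0#

module RingNotation {a ℓ} (R : RawRing a ℓ) where
  open RawRing R public
  open RawSemiringDefs rawSemiring public using (_^_; sum; product)

  infixl 6 _-_
  _-_ : Carrier → Carrier → Carrier
  x - y = x + (- y)

  [_]_ : ℕ → Carrier → Carrier
  [ m ] x = sum {m} λ i → x ^ toℕ i

  ∏[i<_] : ∀ m → (ℕ → Carrier) → Carrier
  ∏[i< m ] f = product {m} λ i → f (toℕ i)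

  ∑-list : ∀ {b} {B : Set b} → List B → (B → Carrier) → Carrier
  ∑-list xs f = foldr (λ x acc → f x + acc) 0# xs

  syntax ∑-list xs (λ x → e) = ∑[ x ∈ xs ] e

  -- F ≈ N / D: the element D is a unit and F is N · D⁻¹.
  infix 4 _≈_/_
  _≈_/_ : Carrier → Carrier → Carrier → Set _
  F ≈ N / D = ∃ λ D⁻¹ → (D * D⁻¹ ≈ 1#) × (F ≈ N * D⁻¹)

ℤ⟦q⟧ : RawRing 0ℓ 0ℓ
ℤ⟦q⟧ = PowerSeries ℤ.+-*-rawRing

-- Series in t and q are series in t over ℤ⟦q⟧, so that F k j is the
-- coefficient of tᵏqʲ in F.
ℤ⟦q⟧⟦t⟧ : RawRing 0ℓ 0ℓ
ℤ⟦q⟧⟦t⟧ = PowerSeries ℤ⟦q⟧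

module ℤ⟦q⟧ = RingNotation ℤ⟦q⟧
module ℤ⟦q⟧⟦t⟧ = RingNotation ℤ⟦q⟧⟦t⟧

q₁ : ℤ⟦q⟧.Carrier
q₁ = variable-X ℤ.+-*-rawRing

q t : ℤ⟦q⟧⟦t⟧.Carrier
q = constant ℤ⟦q⟧ q₁
t = variable-X ℤ⟦q⟧

-- Σ_{k≥0} tᵏ aₖ is by definition the series with coefficients aₖ.
∑tᵏ : (ℕ → ℤ⟦q⟧.Carrier) → ℤ⟦q⟧⟦t⟧.Carrier
∑tᵏ a = a

-- {F}_{qᵖ}: only the terms of q-degree divisible by p are kept.
❴_❵q^_ : ℤ⟦q⟧⟦t⟧.Carrier → ℕ → ℤ⟦q⟧⟦t⟧.Carrier
(❴ F ❵q^ p) k j = if does (p ∣? j) then F k j else 0ℤ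

module Cosets {a ℓ} (𝒢 : Group a ℓ) (z : Group.Carrier 𝒢) where
  open Group 𝒢 hiding (refl; sym; trans)
  open RawMonoidDefs rawMonoid using () renaming (_×_ to pow)
  open Mult monoid using (×-homo-+; ×-assocˡ; ×-congˡ; ×-congʳ)
  open SetoidReasoning setoid

  -- x and y lie in the same coset of the subgroup generated by z.  Natural
  -- exponents suffice because z has finite order wherever this is used.
  infix 4 _∼_
  _∼_ : Carrier → Carrier → Set ℓ
  x ∼ y = ∃ λ k → pow k z ∙ x ≈ y

  ≈⇒∼ : ∀ {x y} → x ≈ y → x ∼ y
  ≈⇒∼ {x} e = 0 , Group.trans 𝒢 (identityˡ x) e

  ∼-trans : ∀ {x y w} → x ∼ y → y ∼ w → x ∼ w
  ∼-trans {x} {y} {w} (j , e) (k , f) = k ℕ.+ j , (begin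
    pow (k ℕ.+ j) z ∙ x          ≈⟨ ∙-congʳ (×-homo-+ z k j) ⟩
    (pow k z ∙ pow j z) ∙ x      ≈⟨ assoc _ _ _ ⟩
    pow k z ∙ (pow j z ∙ x)      ≈⟨ ∙-congˡ e ⟩
    pow k z ∙ y                  ≈⟨ f ⟩
    w                            ∎)

  module FiniteOrder (s : ℕ) .{{_ : NonZero s}} (pow-s : pow s z ≈ ε) where

    pow-ε : ∀ k → pow k ε ≈ ε
    pow-ε zero    = Group.refl 𝒢
    pow-ε (suc k) = Group.trans 𝒢 (identityˡ _) (pow-ε k)

    pow-*s : ∀ k → pow (k ℕ.* s) z ≈ ε
    pow-*s k = begin
      pow (k ℕ.* s) z  ≈⟨ ×-assocˡ z k s ⟨
      pow k (pow s z)  ≈⟨ ×-congʳ k pow-s ⟩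
      pow k ε          ≈⟨ pow-ε k ⟩
      ε                ∎

    ∼-sym : ∀ {x y} → x ∼ y → y ∼ x
    ∼-sym {x} {y} (k , e) = k ℕ.* ℕ.pred s , (begin
      pow (k ℕ.* ℕ.pred s) z ∙ y                 ≈⟨ ∙-congˡ e ⟨
      pow (k ℕ.* ℕ.pred s) z ∙ (pow k z ∙ x)     ≈⟨ assoc _ _ _ ⟨
      (pow (k ℕ.* ℕ.pred s) z ∙ pow k z) ∙ x     ≈⟨ ∙-congʳ (×-homo-+ z (k ℕ.* ℕ.pred s) k) ⟨
      pow (k ℕ.* ℕ.pred s ℕ.+ k) z ∙ x           ≈⟨ ∙-congʳ (×-congˡ exponent) ⟩
      pow (k ℕ.* s) z ∙ x                        ≈⟨ ∙-congʳ (pow-*s k) ⟩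
      ε ∙ x                                      ≈⟨ identityˡ x ⟩
      x                                          ∎)
      where
      exponent : k ℕ.* ℕ.pred s ℕ.+ k ≡ k ℕ.* s
      exponent = trans (ℕₚ.+-comm _ k) (trans (sym (ℕₚ.*-suc k (ℕ.pred s)))
        (cong (k ℕ.*_) (ℕₚ.suc-pred s)))

    reduce : ∀ {x y} → x ∼ y → ∃ λ (j : Fin s) → pow (toℕ j) z ∙ x ≈ y
    reduce {x} {y} (k , e) = k mod s , (begin
      pow (toℕ (k mod s)) z ∙ x                         ≈⟨ ∙-congʳ (×-congˡ (toℕ-fromℕ< (m%n<n k s))) ⟩
      pow (k % s) z ∙ x                                 ≈⟨ ∙-congʳ (identityʳ _) ⟨
      (pow (k % s) z ∙ ε) ∙ x                           ≈⟨ ∙-congʳ (∙-congˡ (pow-*s (k / s))) ⟨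
      (pow (k % s) z ∙ pow (k / s ℕ.* s) z) ∙ x         ≈⟨ ∙-congʳ (×-homo-+ z (k % s) _) ⟨
      pow (k % s ℕ.+ k / s ℕ.* s) z ∙ x                 ≈⟨ ∙-congʳ (×-congˡ (m≡m%n+[m/n]*n k s)) ⟨
      pow k z ∙ x                                       ≈⟨ e ⟩
      y                                                 ∎)

    ∼-dec : (∀ x y → Dec (x ≈ y)) → ∀ x y → Dec (x ∼ y)
    ∼-dec _≈?_ x y = map′ (λ (j , e) → toℕ j , e) reduce
      (any? λ j → (pow (toℕ j) z ∙ x) ≈? y)

R[_] : (m : ℕ) .{{_ : NonZero m}} → ℤ → ℕ
R[ m ] i = i %ℕ m

module _ {r : ℕ} .{{_ : NonZero r}} where

  infixl 6 _⊕_
  _⊕_ : Fin r → Fin r → Fin r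
  a ⊕ b = (toℕ a ℕ.+ toℕ b) mod r

  0ᶜ : Fin r
  0ᶜ = 0 mod r

  ⊖_ : Fin r → Fin r
  ⊖ a = (r ℕ.∸ toℕ a) mod r

  toℕ-mod : ∀ m → toℕ (m mod r) ≡ m % r
  toℕ-mod m = toℕ-fromℕ< (m%n<n m r)

  mod-+ : ∀ m n → (m mod r) ⊕ (n mod r) ≡ (m ℕ.+ n) mod r
  mod-+ m n = toℕ-injective (begin
    toℕ ((m mod r) ⊕ (n mod r))              ≡⟨ toℕ-mod _ ⟩
    (toℕ (m mod r) ℕ.+ toℕ (n mod r)) % r    ≡⟨ cong₂ (λ a b → (a ℕ.+ b) % r) (toℕ-mod m) (toℕ-mod n) ⟩
    (m % r ℕ.+ n % r) % r                    ≡⟨ %-distribˡ-+ m n r ⟨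
    (m ℕ.+ n) % r                            ≡⟨ toℕ-mod _ ⟨
    toℕ ((m ℕ.+ n) mod r)                    ∎)
    where open ≡-Reasoning

  mod-toℕ : ∀ (a : Fin r) → toℕ a mod r ≡ a
  mod-toℕ a = toℕ-injective (trans (toℕ-mod (toℕ a)) (m<n⇒m%n≡m (toℕ<n a)))

  ⊕-comm : ∀ a b → a ⊕ b ≡ b ⊕ a
  ⊕-comm a b = cong (_mod r) (ℕₚ.+-comm (toℕ a) (toℕ b))

  ⊕-assoc : ∀ a b c → (a ⊕ b) ⊕ c ≡ a ⊕ (b ⊕ c)
  ⊕-assoc a b c = begin
    (a ⊕ b) ⊕ c                               ≡⟨ cong ((a ⊕ b) ⊕_) (mod-toℕ c) ⟨
    (a ⊕ b) ⊕ (toℕ c mod r)                   ≡⟨ mod-+ _ _ ⟩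
    ((toℕ a ℕ.+ toℕ b) ℕ.+ toℕ c) mod r       ≡⟨ cong (_mod r) (ℕₚ.+-assoc (toℕ a) (toℕ b) (toℕ c)) ⟩
    (toℕ a ℕ.+ (toℕ b ℕ.+ toℕ c)) mod r       ≡⟨ mod-+ _ _ ⟨
    (toℕ a mod r) ⊕ (b ⊕ c)                   ≡⟨ cong (_⊕ (b ⊕ c)) (mod-toℕ a) ⟩
    a ⊕ (b ⊕ c)                               ∎
    where open ≡-Reasoning

  ⊕-identityˡ : ∀ a → 0ᶜ ⊕ a ≡ a
  ⊕-identityˡ a = begin
    0ᶜ ⊕ a              ≡⟨ cong (0ᶜ ⊕_) (mod-toℕ a) ⟨
    0ᶜ ⊕ (toℕ a mod r)  ≡⟨ mod-+ 0 (toℕ a) ⟩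
    toℕ a mod r         ≡⟨ mod-toℕ a ⟩
    a                   ∎
    where open ≡-Reasoning

  ⊕-identityʳ : ∀ a → a ⊕ 0ᶜ ≡ a
  ⊕-identityʳ a = trans (⊕-comm a 0ᶜ) (⊕-identityˡ a)

  r-mod : r mod r ≡ 0ᶜ
  r-mod = toℕ-injective (trans (toℕ-mod r) (trans (n%n≡0 r) (sym (trans (toℕ-mod 0) (m*n%n≡0 0 r)))))

  ⊕-inverseʳ : ∀ a → a ⊕ (⊖ a) ≡ 0ᶜ
  ⊕-inverseʳ a = begin
    a ⊕ (⊖ a)                            ≡⟨ cong (_⊕ (⊖ a)) (mod-toℕ a) ⟨
    (toℕ a mod r) ⊕ (⊖ a)                ≡⟨ mod-+ (toℕ a) (r ℕ.∸ toℕ a) ⟩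
    (toℕ a ℕ.+ (r ℕ.∸ toℕ a)) mod r      ≡⟨ cong (_mod r) (ℕₚ.m+[n∸m]≡n (ℕₚ.<⇒≤ (toℕ<n a))) ⟩
    r mod r                              ≡⟨ r-mod ⟩
    0ᶜ                                   ∎
    where open ≡-Reasoning

record ColoredPermutation (r n : ℕ) : Set where
  constructor ⟨_︔_⟩
  field
    color : Fin n → Fin r
    perm  : Permutation′ n

open ColoredPermutation

G⟨_,_⟩ : (r n : ℕ) .{{_ : NonZero r}} → Group 0ℓ 0ℓ
G⟨ r , n ⟩ = record
  { Carrier = ColoredPermutation r n
  ; _≈_     = λ g h → (∀ i → color g i ≡ color h i) × perm g Perm.≈ perm h
  -- _∘ₚ_ composes left to right, so perm (g ∙ h) is "first h, then g".
  ; _∙_     = λ g h → ⟨ (λ i → color h i ⊕ color g (perm h ⟨$⟩ʳ i)) ︔ perm h ∘ₚ perm g ⟩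
  ; ε       = ⟨ (λ _ → 0ᶜ) ︔ Perm.id ⟩
  ; _⁻¹     = λ g → ⟨ (λ i → ⊖ color g (perm g ⟨$⟩ˡ i)) ︔ Perm.flip (perm g) ⟩
  ; isGroup = record
    { isMonoid = record
      { isSemigroup = record
        { isMagma = record
          { isEquivalence = record
            { refl  = (λ _ → refl) , (λ _ → refl)
            ; sym   = λ (c , σ) → (λ i → sym (c i)) , (λ i → sym (σ i))
            ; trans = λ (c , σ) (d , τ) → (λ i → trans (c i) (d i)) , (λ i → trans (σ i) (τ i))
            }
          ; ∙-cong = λ {g} {g′} {h} {h′} (c , σ) (d , τ) →
              (λ i → cong₂ _⊕_ (d i) (trans (c _) (cong (color g′) (τ i)))) ,
              (λ i → trans (σ _) (cong (perm g′ ⟨$⟩ʳ_) (τ i)))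
          }
        ; assoc = λ g h k → (λ i → sym (⊕-assoc (color k i) _ _)) , (λ _ → refl)
        }
      ; identity = (λ g → (λ i → ⊕-identityʳ (color g i)) , (λ _ → refl))
                 , (λ g → (λ i → ⊕-identityˡ (color g i)) , (λ _ → refl))
      }
    ; inverse = (λ g → (λ i → trans
                    (cong (λ j → color g i ⊕ (⊖ color g j)) (Perm.inverseˡ (perm g)))
                    (⊕-inverseʳ (color g i)))
                  , (λ _ → Perm.inverseˡ (perm g)))
              , (λ g → (λ i → trans (⊕-comm (⊖ color g (perm g ⟨$⟩ˡ i)) _) (⊕-inverseʳ _))
                  , (λ _ → Perm.inverseʳ (perm g)))
    ; ⁻¹-cong = λ {g} {h} (c , σ) → let σ⁻¹ = flip-cong {g} {h} σ in
          (λ i → cong ⊖_ (trans (c _) (cong (color h) (σ⁻¹ i)))) , σ⁻¹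
    }
  }
  where
  flip-cong : ∀ {g h : ColoredPermutation r n} → perm g Perm.≈ perm h →
              Perm.flip (perm g) Perm.≈ Perm.flip (perm h)
  flip-cong {g} {h} σ i = trans (sym (Perm.inverseˡ (perm h)))
    (cong (perm h ⟨$⟩ˡ_) (trans (sym (σ _)) (Perm.inverseʳ (perm g))))

-- G(r,p,n) consists of the g whose colors sum to 0 modulo p.
colorSum : ∀ {r n} → ColoredPermutation r n → ℕ
colorSum {n = n} g = sum {n} λ i → toℕ (color g i)
  where open RawMonoidDefs ℕ.+-0-rawMonoid using (sum)

-- The generator of C_s.  Its colors are r/s modulo r, hence 0 if s = 1.
γ : ∀ {r s} → s ∣ r → (n : ℕ) .{{_ : NonZero r}} → ColoredPermutation r n
γ {r} s∣r n = ⟨ (λ _ → quotient s∣r mod r) ︔ Perm.id ⟩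

module _ (r p : ℕ) {s : ℕ} (s∣r : s ∣ r) (n : ℕ) .{{_ : NonZero r}} where
  open Group G⟨ r , n ⟩ using (_≈_; ε; rawMonoid)
  open RawMonoidDefs rawMonoid using () renaming (_×_ to pow)
  open Cosets G⟨ r , n ⟩ (γ s∣r n)

  G⟨r,p,n⟩ : Set
  G⟨r,p,n⟩ = Σ (ColoredPermutation r n) λ g → p ∣ colorSum g

  private
    instance
      s≢0 : NonZero s
      s≢0 = positive s∣r
        where
        positive : ∀ {s} → s ∣ r → NonZero s
        positive {zero}  0∣r = contradiction (m∣n⇒n≡m*quotient 0∣r) (ℕ.≢-nonZero⁻¹ r)
        positive {suc _} _   = _

    pow-γ : ∀ k i → color (pow k (γ s∣r n)) i ≡ (k ℕ.* quotient s∣r) mod r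
    pow-γ zero    i = refl
    pow-γ (suc k) i = trans (⊕-comm (color (pow k (γ s∣r n)) i) (quotient s∣r mod r))
      (trans (cong ((quotient s∣r mod r) ⊕_) (pow-γ k i)) (mod-+ (quotient s∣r) (k ℕ.* quotient s∣r)))

    perm-γ : ∀ k i → perm (pow k (γ s∣r n)) ⟨$⟩ʳ i ≡ i
    perm-γ zero    i = refl
    perm-γ (suc k) i = perm-γ k i

    pow-s : pow s (γ s∣r n) ≈ ε
    pow-s = (λ i → trans (pow-γ s i) (trans (cong (_mod r) (sym (m∣n⇒n≡m*quotient s∣r))) r-mod))
          , perm-γ s

    open FiniteOrder s pow-s

  G⟨r,p,s,n⟩ : Setoid 0ℓ 0ℓ
  G⟨r,p,s,n⟩ = record
    { Carrier       = G⟨r,p,n⟩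
    ; _≈_           = λ (g , _) (h , _) → g ∼ h
    ; isEquivalence = record
      { refl  = λ {(g , _)} → ≈⇒∼ {g} {g} (Group.refl G⟨ r , n ⟩ {g})
      ; sym   = λ {(g , _)} {(h , _)} → ∼-sym {g} {h}
      ; trans = λ {(g , _)} {(h , _)} {(l , _)} → ∼-trans {g} {h} {l}
      }
    }

  -- A sum over G(r,p,s,n) is a sum over a list meeting every coset exactly
  -- once; `finite` below shows that such lists exist.

  private
    _≈?_ : ∀ g h → Dec (g ≈ h)
    g ≈? h = all? (λ i → color g i Finₚ.≟ color h i)
       ×-dec all? (λ i → (perm g ⟨$⟩ʳ i) Finₚ.≟ (perm h ⟨$⟩ʳ i))

    decSetoid : DecSetoid 0ℓ 0ℓ
    decSetoid = record
      { isDecEquivalence = record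
        { isEquivalence = Setoid.isEquivalence G⟨r,p,s,n⟩ ; _≟_ = λ (g , _) (h , _) → ∼-dec _≈?_ g h } }

    Code : Set
    Code = Fin (r ℕ.^ n) × Fin (n ℕ.^ n) × Fin (n ℕ.^ n)

    codes : List Code
    codes = cartesianProduct (allFin _) (cartesianProduct (allFin _) (allFin _))

    toPerm : (f f⁻¹ : Fin n → Fin n) → Permutation′ n
    toPerm f f⁻¹ with all? (λ i → f (f⁻¹ i) Finₚ.≟ i) | all? (λ i → f⁻¹ (f i) Finₚ.≟ i)
    ... | yes l | yes r = permutation f f⁻¹ l r
    ... | _     | _     = Perm.id

    toPerm-to : ∀ f f⁻¹ → (∀ i → f (f⁻¹ i) ≡ i) → (∀ i → f⁻¹ (f i) ≡ i) →
                ∀ i → toPerm f f⁻¹ ⟨$⟩ʳ i ≡ f i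
    toPerm-to f f⁻¹ l r i
      with all? (λ i → f (f⁻¹ i) Finₚ.≟ i) | all? (λ i → f⁻¹ (f i) Finₚ.≟ i)
    ... | yes _ | yes _ = refl
    ... | yes _ | no ¬r = contradiction r ¬r
    ... | no ¬l | _     = contradiction l ¬l

    colorSum-cong : ∀ {m} {c d : Fin m → Fin r} {σ τ} → (∀ i → c i ≡ d i) →
                    colorSum ⟨ c ︔ σ ⟩ ≡ colorSum ⟨ d ︔ τ ⟩
    colorSum-cong {zero}          e = refl
    colorSum-cong {suc m} {c} {d} e = cong₂ (λ a b → toℕ a ℕ.+ b) (e zero)
      (colorSum-cong {m} {c ∘ suc} {d ∘ suc} {Perm.id} {Perm.id} (e ∘ suc))

    colorSum-ε : ∀ {m} → colorSum {r} {m} ⟨ (λ _ → 0ᶜ) ︔ Perm.id ⟩ ≡ 0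
    colorSum-ε {zero}  = refl
    colorSum-ε {suc m} = cong₂ ℕ._+_ (trans (toℕ-mod 0) (m*n%n≡0 0 r)) (colorSum-ε {m})

    decode₀ : Code → ColoredPermutation r n
    decode₀ (c , f , f⁻¹) = ⟨ finToFun c ︔ toPerm (finToFun f) (finToFun f⁻¹) ⟩

    restrict : ColoredPermutation r n → G⟨r,p,n⟩
    restrict g with p ∣? colorSum g
    ... | yes d = g , d
    ... | no  _ = ε , ε∈
      where
      ε∈ : p ∣ colorSum {r} {n} ε
      ε∈ rewrite colorSum-ε {n} = p ∣0

    restrict-≈ : ∀ g h → g ≈ proj₁ h → proj₁ (restrict g) ∼ proj₁ h
    restrict-≈ g (h , d) e with p ∣? colorSum g
    ... | yes _ = ≈⇒∼ {g} {h} e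
    ... | no ¬d = contradiction d′ ¬d
      where
      d′ : p ∣ colorSum g
      d′ rewrite colorSum-cong {n} {color g} {color h} {perm g} {perm h} (proj₁ e) = d

    encode : ColoredPermutation r n → Code
    encode g = funToFin (color g) , funToFin (perm g ⟨$⟩ʳ_) , funToFin (perm g ⟨$⟩ˡ_)

    decode-encode : ∀ g → decode₀ (encode g) ≈ g
    decode-encode g = finToFun-funToFin (color g) , λ i →
      trans (toPerm-to _ _ l r′ i) (f≗ i)
      where
      f≗ : ∀ i → finToFun (funToFin (perm g ⟨$⟩ʳ_)) i ≡ perm g ⟨$⟩ʳ i
      f≗ = finToFun-funToFin (perm g ⟨$⟩ʳ_)
      f⁻¹≗ : ∀ i → finToFun (funToFin (perm g ⟨$⟩ˡ_)) i ≡ perm g ⟨$⟩ˡ i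
      f⁻¹≗ = finToFun-funToFin (perm g ⟨$⟩ˡ_)
      l : ∀ i → finToFun (funToFin (perm g ⟨$⟩ʳ_)) (finToFun (funToFin (perm g ⟨$⟩ˡ_)) i) ≡ i
      l i = trans (f≗ _) (trans (cong (perm g ⟨$⟩ʳ_) (f⁻¹≗ i)) (Perm.inverseʳ (perm g)))
      r′ : ∀ i → finToFun (funToFin (perm g ⟨$⟩ˡ_)) (finToFun (funToFin (perm g ⟨$⟩ʳ_)) i) ≡ i
      r′ i = trans (f⁻¹≗ _) (trans (cong (perm g ⟨$⟩ˡ_) (f≗ i)) (Perm.inverseˡ (perm g)))

    all : List G⟨r,p,n⟩
    all = List.map (restrict ∘ decode₀) codes

    all-enumerates : IsEnumeration G⟨r,p,s,n⟩ all
    all-enumerates g = Any.map⁺ (Any.map (λ { refl → ∼-sym {proj₁ (restrict (decode₀ (encode (proj₁ g))))} {proj₁ g}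
        (restrict-≈ _ g (decode-encode (proj₁ g))) })
      (∈-cartesianProduct⁺ (∈-allFin _) (∈-cartesianProduct⁺ (∈-allFin _) (∈-allFin _))))

  finite : ∃ λ gs → IsEnumeration G⟨r,p,s,n⟩ gs × Unique G⟨r,p,s,n⟩ gs
  finite = deduplicate (DecSetoid._≟_ decSetoid) all
         , Enumerates.deduplicate⁺ decSetoid all-enumerates
         , UniqueDec.deduplicate-! decSetoid all

-- Positions are elements of Fin n with n = suc m: position i of the
-- mathematics is the element of Fin n with toℕ equal to i - 1.
module _ {r p : ℕ} {s} (s∣r : s ∣ r) {m : ℕ} .{{_ : NonZero r}} where

  private
    G = G⟨r,p,n⟩ r p s∣r (suc m)

  HDes : G → Fin m → Set
  HDes (⟨ c ︔ σ ⟩ , _) i =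
    c (inject₁ i) ≡ c (suc i) × (σ ⟨$⟩ʳ inject₁ i) Fin.> (σ ⟨$⟩ʳ suc i)

  HDes? : ∀ g i → Dec (HDes g i)
  HDes? (⟨ c ︔ σ ⟩ , _) i =
    (c (inject₁ i) Finₚ.≟ c (suc i)) ×-dec ((σ ⟨$⟩ʳ suc i) Finₚ.<? (σ ⟨$⟩ʳ inject₁ i))

  h : G → Fin (suc m) → ℕ
  h g i = length (filter (λ j → (toℕ i ℕₚ.≤? toℕ j) ×-dec HDes? g j) (allFin m))

  -- The last position carries R_{r/s}(c_n); c ∘ suc drops the first position.
  kᶜ : ∀ {m} → (Fin (suc m) → Fin r) → Fin (suc m) → ℕ
  kᶜ {zero}  c zero    = R[ quotient s∣r ] {{quotient≢0 s∣r}} (ℤ.+ toℕ (c zero))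
  kᶜ {suc m} c zero    = kᶜ (c ∘ suc) zero ℕ.+ R[ r ] (ℤ.+ toℕ (c zero) ℤ.- ℤ.+ toℕ (c (suc zero)))
  kᶜ {suc m} c (suc i) = kᶜ (c ∘ suc) i

  k : G → Fin (suc m) → ℕ
  k (⟨ c ︔ _ ⟩ , _) = kᶜ c

  λ′ : G → Fin (suc m) → ℕ
  λ′ g i = r ℕ.* h g i ℕ.+ k g i

  fmaj : G → ℕ
  fmaj g = sum {suc m} (λ′ g)
    where open RawMonoidDefs ℕ.+-0-rawMonoid using (sum)

  fdes : G → ℕ
  fdes g = λ′ g zero

{-# OPTIONS --safe #-}

-- The coefficient of t^k in the left-hand side enumerates the f ∈ {0,…,k}ⁿ with p ∣ |f| by q^|f|.
-- Sort f decreasingly, breaking ties from left to right, by a permutation σ; the residues of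
-- f(σ(1)), …, f(σ(n)) modulo r colour σ, and this defines the class of f in G(r,p,s,n).  For a
-- representative (c;σ) of a class g, the f in that class are exactly those for which l = f ∘ σ
-- has l_n ∈ R_{r/s}(c_n) + (r/s)ℕ and l_i − l_{i+1} ∈ r[i ∈ HDes(g)] + R_r(c_i − c_{i+1}) + rℕ,
-- and λ(g) is the smallest such l.  Recording t^(l_1) q^|l|, each gap contributes a geometric
-- series, and prepending a part to l amounts to the substitution t ↦ tq.  Hence the class of g
-- contributes t^fdes(g) q^fmaj(g) divided by the common denominator, where the factor 1/(1 − t)
-- turns "l_1 = k" into "l_1 ≤ k".

module Submission where

open import Algebra.Bundles using (CommutativeRing; Group)
open import Algebra.Bundles.Raw using (RawRing)
import Algebra.Definitions.RawMonoid as RawMonoidDefs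
import Algebra.Properties.CommutativeMonoid.Sum as CommutativeMonoidSum
import Algebra.Properties.CommutativeSemigroup as CommutativeSemigroupProperties
import Algebra.Properties.CommutativeSemiring.Exp as CommutativeSemiringExp
import Algebra.Properties.Ring as RingProperties
import Algebra.Properties.Semiring.Exp as SemiringExp
import Algebra.Properties.Semiring.Sum as SemiringSum
open import Data.Bool.Base using (if_then_else_; true; false)
open import Data.Empty using (⊥)
open import Data.Fin.Base as Fin
  using (Fin; zero; suc; toℕ; fromℕ; fromℕ<; inject₁; _↑ˡ_; _↑ʳ_; combine; finToFun; funToFin)
open import Data.Fin.Permutation as Perm
  using (Permutation′; permutation; _⟨$⟩ʳ_; _⟨$⟩ˡ_; inverseʳ; inverseˡ)
import Data.Fin.Properties as Finₚ
open import Data.Fin.Subset using (Subset; ∣_∣)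
open import Data.Fin.Subset.Properties using (p⊂q⇒∣p∣<∣q∣; ∣⊤∣≡n; ∈⊤)
open import Data.Integer.Base as ℤ using (0ℤ)
open import Data.Integer.DivMod using (_/ℕ_; n%ℕd<d; a≡a%ℕn+[a/ℕn]*n)
import Data.Integer.Properties as ℤₚ
import Data.Integer.Tactic.RingSolver as ℤSolver
open import Data.List.Base as List using (List; []; _∷_; length; filter)
open import Data.List.Relation.Unary.All as All using (All; []; _∷_)
import Data.List.Relation.Unary.All.Properties as Allₚ
open import Data.List.Relation.Unary.AllPairs as AllPairs using (AllPairs; []; _∷_)
open import Data.List.Relation.Unary.Any as Any using (Any; here; there)
open import Data.List.Relation.Unary.Enumerates.Setoid using (IsEnumeration)
open import Data.List.Relation.Unary.Unique.Setoid using (Unique)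
open import Data.Nat.Base as ℕ using (ℕ; zero; suc; NonZero; _∸_; _≤_; z≤n; s≤s; z<s; s<s⁻¹)
open import Data.Nat.Divisibility
import Data.Nat.Properties as ℕₚ
open import Data.Nat.Tactic.RingSolver using (solve-∀)
open import Data.Product.Base using (_,_; _×_; ∃; ∃₂; proj₁; proj₂)
open import Data.Product.Relation.Binary.Lex.Strict using (×-Lex; ×-compare; ×-transitive)
open import Data.Sum.Base using (inj₁; inj₂)
import Data.Vec.Base as Vec
open import Data.Vec.Functional using () renaming (_∷_ to _◂_)
open import Data.Vec.Properties using (lookup∘tabulate; lookup⇒[]=; []=⇒lookup)
open import Function.Base using (_∘_; id)
open import Function.Bundles using (_⇔_; mk⇔; Equivalence)
open import Function.Definitions using (Injective)
open import Level using (0ℓ)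
open import Relation.Binary.Bundles using (Setoid)
open import Relation.Binary.Core using (Rel)
open import Relation.Binary.Definitions using (Transitive; Trichotomous; tri<; tri≈; tri>)
open import Relation.Binary.PropositionalEquality as ≡ using (_≡_; _≢_; _≗_)
import Relation.Binary.Reasoning.Setoid as SetoidReasoning
open import Relation.Binary.Structures using (IsStrictTotalOrder)
open import Relation.Binary.Structures.Biased using (isStrictTotalOrderᶜ)
open import Relation.Nullary using (Dec; yes; no; does; ¬_; contradiction)
open import Relation.Nullary.Decidable using (_×-dec_; dec-true; dec-false; does-⇔)
open import Relation.Unary using (Decidable)
open import Defs

-- The ring of power series

-- The last part of l is prescribed only modulo r/s. Hence the residues of l agree with the colours
-- of a representative only up to one common multiple of r/s added to all of them, which is a power
-- of `γ`. So admissibility is a property of the class, and this is also why the last factor of the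
-- denominator carries r/s in place of r. Adding k·(r/s) to all n colours changes their sum by
-- n·k·(r/s), a multiple of p because ps ∣ rn. As p ∣ r, the condition p ∣ |f| therefore says
-- exactly that the class of f lies in G(r,p,n). The representatives come as an arbitrary list, so
-- no bijection with normal forms is built. For each f the indicators of admissibility, summed over
-- the list, give 1 or 0. The two sums are then exchanged, and for each g separately f is replaced
-- by f ∘ σ, which removes σ and leaves only a condition on gaps. The substitution t ↦ tq is a ring
-- endomorphism, so it carries closed forms to closed forms and units to units.

module PowerSeriesRing {c ℓ} (R : CommutativeRing c ℓ) where
  open CommutativeRing R
  open CommutativeSemigroupProperties +-commutativeSemigroup using (interchange)
  open SetoidReasoning setoid
  private module S = RingNotation (PowerSeries rawRing)

  -- At `suc k` a product unfolds by definition into `f 0 * g (suc k) + (tail f * g) k`. The ring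
  -- laws are therefore inductions on the coefficient in which the left factor is replaced by its
  -- tail.
  tail : S.Carrier → S.Carrier
  tail f = f ∘ suc

  infixr 7 _•_
  _•_ : Carrier → S.Carrier → S.Carrier
  (a • f) k = a * f k

  ⊛-cong : ∀ {f f′ g g′} → f S.≈ f′ → g S.≈ g′ → f S.* g S.≈ f′ S.* g′
  ⊛-cong e e′ zero    = +-congʳ (*-cong (e 0) (e′ 0))
  ⊛-cong e e′ (suc k) = +-cong (*-cong (e 0) (e′ (suc k))) (⊛-cong (e ∘ suc) e′ k)

  ⊛-distribʳ-+ : ∀ h f g → (f S.+ g) S.* h S.≈ f S.* h S.+ g S.* h
  ⊛-distribʳ-+ h f g zero    =
    trans (+-cong (distribʳ _ _ _) (sym (+-identityʳ 0#))) (interchange _ _ _ _)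
  ⊛-distribʳ-+ h f g (suc k) =
    trans (+-cong (distribʳ _ _ _) (⊛-distribʳ-+ h (tail f) (tail g) k)) (interchange _ _ _ _)

  •-⊛-assoc : ∀ a f g → (a • f) S.* g S.≈ a • (f S.* g)
  •-⊛-assoc a f g zero    = trans (+-cong (*-assoc _ _ _) (sym (zeroʳ a))) (sym (distribˡ _ _ _))
  •-⊛-assoc a f g (suc k) = trans (+-cong (*-assoc _ _ _) (•-⊛-assoc a (tail f) g k)) (sym (distribˡ _ _ _))

  ⊛-zeroˡ : ∀ f → S.0# S.* f S.≈ S.0#
  ⊛-zeroˡ f zero    = trans (+-identityʳ _) (zeroˡ _)
  ⊛-zeroˡ f (suc k) = trans (+-cong (zeroˡ _) (⊛-zeroˡ f k)) (+-identityʳ _)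

  ⊛-identityˡ : ∀ f → S.1# S.* f S.≈ f
  ⊛-identityˡ f zero    = trans (+-identityʳ _) (*-identityˡ _)
  ⊛-identityˡ f (suc k) = trans (+-cong (*-identityˡ _) (⊛-zeroˡ f k)) (+-identityʳ _)

  -- The definition peels off the first summand of the convolution. Commutativity also needs the
  -- last one, where the tail of the right factor appears.
  ⊛-sucʳ : ∀ f g k → (f S.* g) (suc k) ≈ (f S.* tail g) k + f (suc k) * g 0
  ⊛-sucʳ f g zero    = sym (trans (+-congʳ (+-identityʳ _)) (+-congˡ (sym (+-identityʳ _))))
  ⊛-sucʳ f g (suc k) = trans (+-congˡ (⊛-sucʳ (tail f) g k)) (sym (+-assoc _ _ _))

  ⊛-comm : ∀ f g → f S.* g S.≈ g S.* f
  ⊛-comm f g zero    = +-congʳ (*-comm _ _)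
  ⊛-comm f g (suc k) = begin
    f 0 * g (suc k) + (tail f S.* g) k ≈⟨ +-cong (*-comm _ _) (⊛-comm (tail f) g k) ⟩
    g (suc k) * f 0 + (g S.* tail f) k ≈⟨ +-comm _ _ ⟩
    (g S.* tail f) k + g (suc k) * f 0 ≈⟨ ⊛-sucʳ g f k ⟨
    (g S.* f) (suc k)                  ∎

  -- By definition the tail of `f * g` is `f 0 • tail g + tail f * g`. Distributivity and
  -- `•-⊛-assoc` then reduce the claim to `tail f`.
  ⊛-assoc : ∀ f g h → (f S.* g) S.* h S.≈ f S.* (g S.* h)
  ⊛-assoc f g h zero    = begin
    (f 0 * g 0 + 0#) * h 0 + 0#   ≈⟨ +-identityʳ _ ⟩
    (f 0 * g 0 + 0#) * h 0        ≈⟨ *-congʳ (+-identityʳ _) ⟩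
    f 0 * g 0 * h 0               ≈⟨ *-assoc _ _ _ ⟩
    f 0 * (g 0 * h 0)             ≈⟨ *-congˡ (+-identityʳ _) ⟨
    f 0 * (g 0 * h 0 + 0#)        ≈⟨ +-identityʳ _ ⟨
    f 0 * (g 0 * h 0 + 0#) + 0#   ∎
  ⊛-assoc f g h (suc k) = begin
    (f 0 * g 0 + 0#) * h (suc k) + (tail (f S.* g) S.* h) k
      ≈⟨ +-cong (trans (*-congʳ (+-identityʳ _)) (*-assoc _ _ _)) (⊛-distribʳ-+ h (f 0 • tail g) (tail f S.* g) k) ⟩
    f 0 * (g 0 * h (suc k)) + (((f 0 • tail g) S.* h) k + ((tail f S.* g) S.* h) k)
      ≈⟨ +-congˡ (+-cong (•-⊛-assoc (f 0) (tail g) h k) (⊛-assoc (tail f) g h k)) ⟩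
    f 0 * (g 0 * h (suc k)) + (f 0 * (tail g S.* h) k + (tail f S.* (g S.* h)) k)
      ≈⟨ +-assoc _ _ _ ⟨
    (f 0 * (g 0 * h (suc k)) + f 0 * (tail g S.* h) k) + (tail f S.* (g S.* h)) k
      ≈⟨ +-congʳ (distribˡ _ _ _) ⟨
    f 0 * (g S.* h) (suc k) + (tail f S.* (g S.* h)) k ∎

  powerSeriesRing : CommutativeRing c ℓ
  powerSeriesRing = record
    { RawRing (PowerSeries rawRing) using (Carrier; _≈_; _+_; _*_; -_; 0#; 1#)
    ; isCommutativeRing = record
      { isRing = record
        { +-isAbelianGroup = record
          { isGroup = record
            { isMonoid = record
              { isSemigroup = record
                { isMagma = record
                  { isEquivalence = record
                    { refl = λ _ → refl ; sym = λ e k → sym (e k) ; trans = λ e e′ k → trans (e k) (e′ k) }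
                  ; ∙-cong = λ e e′ k → +-cong (e k) (e′ k) }
                ; assoc = λ f g h k → +-assoc (f k) (g k) (h k) }
              ; identity = (λ f k → +-identityˡ (f k)) , (λ f k → +-identityʳ (f k)) }
            ; inverse = (λ f k → -‿inverseˡ (f k)) , (λ f k → -‿inverseʳ (f k))
            ; ⁻¹-cong = λ e k → -‿cong (e k) }
          ; comm = λ f g k → +-comm (f k) (g k) }
        ; *-cong = ⊛-cong
        ; *-assoc = ⊛-assoc
        ; *-identity = ⊛-identityˡ , λ f k → trans (⊛-comm f S.1# k) (⊛-identityˡ f k)
        ; distrib = (λ h f g k → trans (⊛-comm h (f S.+ g) k) (trans (⊛-distribʳ-+ h f g k)
                      (+-cong (⊛-comm f h k) (⊛-comm g h k))))
                  , ⊛-distribʳ-+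
        }
      ; *-comm = ⊛-comm
      }
    }

-- Generating functions of sequences with prescribed gaps

-- The bound excludes truncated differences, which are 0 and so divisible by `u`. The bound in `Gap`
-- has the same purpose.
Reach : (u d l : ℕ) → Set
Reach u d l = d ≤ l × u ∣ l ∸ d

reach? : ∀ u d l → Dec (Reach u d l)
reach? u d l = (d ℕₚ.≤? l) ×-dec (u ∣? l ∸ d)

reach-suc : ∀ {u d l} → Reach u d l ⇔ Reach u (suc d) (suc l)
reach-suc = mk⇔ (λ (d≤l , u∣) → s≤s d≤l , u∣) (λ (d<l , u∣) → ℕ.s≤s⁻¹ d<l , u∣)

reach-+ : ∀ {u l} → Reach u 0 l ⇔ Reach u 0 (u ℕ.+ l)
reach-+ {u} = mk⇔ (λ (_ , u∣l) → z≤n , ∣m∣n⇒∣m+n ∣-refl u∣l) (λ (_ , u∣u+l) → z≤n , ∣m+n∣m⇒∣n u∣u+l ∣-refl)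

-- For the gaps and base of a group element g these are λ₁(g), …, λₙ(g).
partSizes : ∀ {m} → (Fin m → ℕ) → ℕ → Fin (suc m) → ℕ
partSizes {zero}  d e _       = e
partSizes {suc m} d e zero    = d zero ℕ.+ partSizes (d ∘ suc) e zero
partSizes {suc m} d e (suc i) = partSizes (d ∘ suc) e i

module ℕΣ = CommutativeMonoidSum ℕₚ.+-0-commutativeMonoid

module Indicator {c ℓ} (R : CommutativeRing c ℓ) where
  open CommutativeRing R

  𝟙 : ∀ {a} {A : Set a} → Dec A → Carrier
  𝟙 A? = if does A? then 1# else 0#

  module _ {a} {A : Set a} (A? : Dec A) where

    𝟙-true : A → 𝟙 A? ≈ 1#
    𝟙-true a rewrite dec-true A? a = refl

    𝟙-false : ¬ A → 𝟙 A? ≈ 0#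
    𝟙-false ¬a rewrite dec-false A? ¬a = refl

    𝟙-cong : ∀ {b} {B : Set b} (B? : Dec B) → A ⇔ B → 𝟙 A? ≈ 𝟙 B?
    𝟙-cong B? A⇔B rewrite does-⇔ A⇔B A? B? = refl

  𝟙-× : ∀ {a b} {A : Set a} {B : Set b} (A? : Dec A) (B? : Dec B) → 𝟙 (A? ×-dec B?) ≈ 𝟙 A? * 𝟙 B?
  𝟙-× (yes _) B? = sym (*-identityˡ _)
  𝟙-× (no _)  B? = sym (zeroˡ _)

module Units {c ℓ} (R : CommutativeRing c ℓ) where
  open CommutativeRing R
  open CommutativeSemigroupProperties *-commutativeSemigroup using (interchange)

  Unit : Carrier → Set _
  Unit x = ∃ λ y → x * y ≈ 1#

  unit-cong : ∀ {x y} → x ≈ y → Unit x → Unit y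
  unit-cong e (z , f) = z , trans (*-congʳ (sym e)) f

  unit-* : ∀ {x y} → Unit x → Unit y → Unit (x * y)
  unit-* {x} {y} (x′ , e) (y′ , f) = x′ * y′ ,
    trans (interchange x y x′ y′) (trans (*-cong e f) (*-identityˡ 1#))

module GapSeries {c ℓ} (R : CommutativeRing c ℓ) (x : CommutativeRing.Carrier R) where
  private
    module R = CommutativeRing R
  open RingNotation R.rawRing using () renaming (_^_ to _^ᴿ_)
  open PowerSeriesRing R using (powerSeriesRing; tail; _•_; •-⊛-assoc; ⊛-cong)
  open Indicator R
  open CommutativeRing powerSeriesRing hiding (_-_; zero)
  open RingNotation (PowerSeries R.rawRing) using (_^_; _-_; product; ∏[i<_])
  open SemiringExp semiring using (^-congˡ; ^-homo-*)
  open CommutativeSemiringExp commutativeSemiring using (^-distrib-*)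
  open CommutativeSemigroupProperties *-commutativeSemigroup using (interchange)
  open RingProperties ring using (-‿distribˡ-*)
  open Units powerSeriesRing

  𝐭 𝐪 : Carrier
  𝐭 = variable-X R.rawRing
  𝐪 = constant R.rawRing x

  shift : ℕ → Carrier → Carrier
  shift zero    F k       = F k
  shift (suc a) F zero    = R.0#
  shift (suc a) F (suc k) = shift a F k

  shift-+ : ∀ a F k → shift a F (a ℕ.+ k) R.≈ F k
  shift-+ zero    F k = R.refl
  shift-+ (suc a) F k = shift-+ a F k

  shift-< : ∀ a F {k} → k ℕ.< a → shift a F k R.≈ R.0#
  shift-< (suc a) F {zero}  _   = R.refl
  shift-< (suc a) F {suc k} k<a = shift-< a F (ℕ.s≤s⁻¹ k<a)

  tail-t : tail 𝐭 ≈ 1#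
  tail-t zero    = R.refl
  tail-t (suc k) = R.refl

  t-* : ∀ F → 𝐭 * F ≈ shift 1 F
  t-* F zero    = R.trans (R.+-identityʳ _) (R.zeroˡ _)
  t-* F (suc k) = R.trans (R.+-cong (R.zeroˡ _)
    (R.trans (⊛-cong {tail 𝐭} {1#} {F} tail-t (λ _ → R.refl) k) (*-identityˡ F k))) (R.+-identityˡ _)

  𝐭^-* : ∀ a F → 𝐭 ^ a * F ≈ shift a F
  𝐭^-* zero    F = *-identityˡ F
  𝐭^-* (suc a) F k = R.trans (*-assoc 𝐭 (𝐭 ^ a) F k) (R.trans (t-* (𝐭 ^ a * F) k) (step k))
    where
    step : shift 1 (𝐭 ^ a * F) ≈ shift (suc a) F
    step zero    = R.refl
    step (suc k) = 𝐭^-* a F k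

  -- The series t^d / (1 − t^u).
  X : (u d : ℕ) → Carrier
  X u d l = 𝟙 (reach? u d l)

  X-shift : ∀ u d → X u d ≈ shift d (X u 0)
  X-shift u zero    l       = R.refl
  X-shift u (suc d) zero    = 𝟙-false (reach? u (suc d) 0) λ ()
  X-shift u (suc d) (suc l) = R.trans
    (R.sym (𝟙-cong (reach? u d l) (reach? u (suc d) (suc l)) reach-suc)) (X-shift u d l)

  -- The recursion of the geometric series, from which `geometric₀` obtains the inverse of
  -- `1 - t^u`. As `u` is nonzero, the shifted copy starts above degree 0, and no positive degree
  -- below `u` is a multiple of `u`.
  X-unfold : ∀ u .{{_ : NonZero u}} → X u 0 ≈ 1# + shift u (X u 0)
  X-unfold u zero = R.trans (𝟙-true (reach? u 0 0) (z≤n , u ∣0))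
    (R.sym (R.trans (R.+-congˡ (shift-< u (X u 0) (ℕ.>-nonZero⁻¹ u))) (R.+-identityʳ _)))
  X-unfold u l@(suc _) with u ℕₚ.≤? l
  ... | no u≰l = R.trans (𝟙-false (reach? u 0 l) λ (_ , u∣l) → u≰l (∣⇒≤ u∣l))
    (R.sym (R.trans (R.+-identityˡ _) (shift-< u (X u 0) (ℕₚ.≰⇒> u≰l))))
  ... | yes u≤l = ≡.subst (λ k → X u 0 k R.≈ shift u (X u 0) k) (ℕₚ.m+[n∸m]≡n u≤l)
    (R.trans (R.sym (𝟙-cong (reach? u 0 _) (reach? u 0 _) reach-+)) (R.sym (shift-+ u (X u 0) _)))
    ⟨≈⟩ R.sym (R.+-identityˡ _)
    where
    infixr 2 _⟨≈⟩_
    _⟨≈⟩_ : ∀ {a b c} → a R.≈ b → b R.≈ c → a R.≈ c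
    _⟨≈⟩_ = R.trans

  module _ (u : ℕ) .{{_ : NonZero u}} where
    open SetoidReasoning setoid

    geometric₀ : (1# - 𝐭 ^ u) * X u 0 ≈ 1#
    geometric₀ = begin
      (1# - 𝐭 ^ u) * X u 0                    ≈⟨ distribʳ (X u 0) 1# (- (𝐭 ^ u)) ⟩
      1# * X u 0 + (- (𝐭 ^ u)) * X u 0        ≈⟨ +-cong (*-identityˡ (X u 0)) (sym (-‿distribˡ-* (𝐭 ^ u) (X u 0))) ⟩
      X u 0 - 𝐭 ^ u * X u 0                   ≈⟨ +-congʳ {x = - (𝐭 ^ u * X u 0)} (X-unfold u) ⟩
      1# + shift u (X u 0) - 𝐭 ^ u * X u 0    ≈⟨ +-congʳ {x = - (𝐭 ^ u * X u 0)} (+-congˡ {x = 1#} (sym (𝐭^-* u (X u 0)))) ⟩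
      1# + 𝐭 ^ u * X u 0 - 𝐭 ^ u * X u 0      ≈⟨ +-assoc 1# (𝐭 ^ u * X u 0) (- (𝐭 ^ u * X u 0)) ⟩
      1# + (𝐭 ^ u * X u 0 - 𝐭 ^ u * X u 0)    ≈⟨ +-congˡ {x = 1#} (-‿inverseʳ (𝐭 ^ u * X u 0)) ⟩
      1# + 0#                                 ≈⟨ +-identityʳ 1# ⟩
      1#                                      ∎

    unit-1-t^ : Unit (1# - 𝐭 ^ u)
    unit-1-t^ = X u 0 , geometric₀

    geometric : ∀ d → X u d * (1# - 𝐭 ^ u) ≈ 𝐭 ^ d
    geometric d = begin
      X u d * (1# - 𝐭 ^ u)                ≈⟨ *-congʳ {x = 1# - 𝐭 ^ u} (X-shift u d) ⟩
      shift d (X u 0) * (1# - 𝐭 ^ u)      ≈⟨ *-congʳ {x = 1# - 𝐭 ^ u} (𝐭^-* d (X u 0)) ⟨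
      𝐭 ^ d * X u 0 * (1# - 𝐭 ^ u)        ≈⟨ *-assoc (𝐭 ^ d) (X u 0) (1# - 𝐭 ^ u) ⟩
      𝐭 ^ d * (X u 0 * (1# - 𝐭 ^ u))      ≈⟨ *-congˡ {x = 𝐭 ^ d} (*-comm (X u 0) (1# - 𝐭 ^ u)) ⟩
      𝐭 ^ d * ((1# - 𝐭 ^ u) * X u 0)      ≈⟨ *-congˡ {x = 𝐭 ^ d} geometric₀ ⟩
      𝐭 ^ d * 1#                          ≈⟨ *-identityʳ (𝐭 ^ d) ⟩
      𝐭 ^ d                               ∎

  -- The substitution t ↦ tq.
  φ : Carrier → Carrier
  φ F l = x ^ᴿ l R.* F l

  φ-cong : ∀ {F G} → F ≈ G → φ F ≈ φ G
  φ-cong e l = R.*-congˡ (e l)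

  -- Dropping a coefficient lowers the remaining degrees by one, which costs one factor `x`. This
  -- drives the induction for `φ-*`.
  φ-tail : ∀ F → tail (φ F) ≈ x • φ (tail F)
  φ-tail F l = R.*-assoc x (x ^ᴿ l) (F (suc l))

  φ-* : ∀ F G → φ (F * G) ≈ φ F * φ G
  φ-* F G zero = R.trans (R.*-identityˡ _)
    (R.sym (R.+-congʳ (R.*-cong (R.*-identityˡ _) (R.*-identityˡ _))))
  φ-* F G (suc k) = begin
    x ^ᴿ suc k R.* (F 0 R.* G (suc k) R.+ (tail F * G) k)
      ≈⟨ R.distribˡ _ _ _ ⟩
    x ^ᴿ suc k R.* (F 0 R.* G (suc k)) R.+ x ^ᴿ suc k R.* (tail F * G) k
      ≈⟨ R.+-cong (RC.x∙yz≈y∙xz _ _ _) (R.*-assoc x (x ^ᴿ k) _) ⟩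
    F 0 R.* φ G (suc k) R.+ x R.* φ (tail F * G) k
      ≈⟨ R.+-cong (R.*-congʳ (R.sym (R.*-identityˡ _))) (R.*-congˡ (φ-* (tail F) G k)) ⟩
    φ F 0 R.* φ G (suc k) R.+ x R.* (φ (tail F) * φ G) k
      ≈⟨ R.+-congˡ (R.sym (R.trans (⊛-cong {g = φ G} {g′ = φ G} (φ-tail F) (λ _ → R.refl) k)
           (•-⊛-assoc x (φ (tail F)) (φ G) k))) ⟩
    (φ F * φ G) (suc k) ∎
    where
    open SetoidReasoning R.setoid
    module RC = CommutativeSemigroupProperties R.*-commutativeSemigroup

  φ-1# : φ 1# ≈ 1#
  φ-1# zero    = R.*-identityˡ _
  φ-1# (suc k) = R.zeroʳ _

  φ-q : φ 𝐪 ≈ 𝐪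
  φ-q zero    = R.*-identityˡ _
  φ-q (suc k) = R.zeroʳ _

  φ-t : φ 𝐭 ≈ 𝐭 * 𝐪
  φ-t k = R.trans (coefficient k) (R.sym (t-* 𝐪 k))
    where
    coefficient : φ 𝐭 ≈ shift 1 𝐪
    coefficient zero          = R.zeroʳ _
    coefficient (suc zero)    = R.trans (R.*-identityʳ _) (R.*-identityʳ _)
    coefficient (suc (suc k)) = R.zeroʳ _

  φ-1- : ∀ F → φ (1# - F) ≈ 1# - φ F
  φ-1- F k = R.trans (R.distribˡ _ _ _) (R.+-cong (φ-1# k)
    (R.sym (RingProperties.-‿distribʳ-* R.ring (x ^ᴿ k) (F k))))

  φ-^ : ∀ F a → φ (F ^ a) ≈ φ F ^ a
  φ-^ F zero    = φ-1#
  φ-^ F (suc a) = trans {φ (F ^ suc a)} {φ F * φ (F ^ a)} {φ F ^ suc a}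
    (φ-* F (F ^ a)) (*-congˡ {x = φ F} (φ-^ F a))

  φ-product : ∀ {m} (F : Fin m → Carrier) → φ (product F) ≈ product (φ ∘ F)
  φ-product {zero}  F = φ-1#
  φ-product {suc m} F = trans {φ (product F)} {φ (F zero) * φ (product (F ∘ suc))} {product (φ ∘ F)}
    (φ-* (F zero) (product (F ∘ suc))) (*-congˡ {x = φ (F zero)} (φ-product (F ∘ suc)))

  product-cong : ∀ {m} {F G : Fin m → Carrier} → (∀ i → F i ≈ G i) → product F ≈ product G
  product-cong {zero}  e = refl {1#}
  product-cong {suc m} {F} {G} e =
    *-cong {F zero} {G zero} {product (F ∘ suc)} {product (G ∘ suc)} (e zero) (product-cong (e ∘ suc))

  φ-unit : ∀ {F} → Unit F → Unit (φ F)
  φ-unit {F} (G , e) = φ G , trans {φ F * φ G} {φ (F * G)} {1#}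
    (sym {φ (F * G)} {φ F * φ G} (φ-* F G)) (trans {φ (F * G)} {φ 1#} {1#} (φ-cong {F * G} {1#} e) φ-1#)

  open SetoidReasoning setoid

  φ-t^q^ : ∀ a b → φ (𝐭 ^ a * 𝐪 ^ b) ≈ 𝐭 ^ a * 𝐪 ^ (a ℕ.+ b)
  φ-t^q^ a b = begin
    φ (𝐭 ^ a * 𝐪 ^ b)        ≈⟨ φ-* (𝐭 ^ a) (𝐪 ^ b) ⟩
    φ (𝐭 ^ a) * φ (𝐪 ^ b)    ≈⟨ *-cong {φ (𝐭 ^ a)} {φ 𝐭 ^ a} {φ (𝐪 ^ b)} {φ 𝐪 ^ b} (φ-^ 𝐭 a) (φ-^ 𝐪 b) ⟩
    φ 𝐭 ^ a * φ 𝐪 ^ b        ≈⟨ *-cong {φ 𝐭 ^ a} {(𝐭 * 𝐪) ^ a} {φ 𝐪 ^ b} {𝐪 ^ b} (^-congˡ a φ-t) (^-congˡ b φ-q) ⟩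
    (𝐭 * 𝐪) ^ a * 𝐪 ^ b      ≈⟨ *-congʳ {x = 𝐪 ^ b} (^-distrib-* 𝐭 𝐪 a) ⟩
    𝐭 ^ a * 𝐪 ^ a * 𝐪 ^ b    ≈⟨ *-assoc (𝐭 ^ a) (𝐪 ^ a) (𝐪 ^ b) ⟩
    𝐭 ^ a * (𝐪 ^ a * 𝐪 ^ b)  ≈⟨ *-congˡ {x = 𝐭 ^ a} (^-homo-* 𝐪 a b) ⟨
    𝐭 ^ a * 𝐪 ^ (a ℕ.+ b)    ∎

  -- The substitution adds the exponent of t to that of q, so a factor with q-exponent `i * a`
  -- becomes the one with `suc i * a`.
  φ-factor : ∀ a b → φ (1# - 𝐭 ^ a * 𝐪 ^ b) ≈ 1# - 𝐭 ^ a * 𝐪 ^ (a ℕ.+ b)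
  φ-factor a b = begin
    φ (1# - 𝐭 ^ a * 𝐪 ^ b)        ≈⟨ φ-1- (𝐭 ^ a * 𝐪 ^ b) ⟩
    1# - φ (𝐭 ^ a * 𝐪 ^ b)        ≈⟨ +-congˡ {x = 1#} (-‿cong {φ (𝐭 ^ a * 𝐪 ^ b)} {𝐭 ^ a * 𝐪 ^ (a ℕ.+ b)} (φ-t^q^ a b)) ⟩
    1# - 𝐭 ^ a * 𝐪 ^ (a ℕ.+ b)    ∎

  -- The exponent is left as `1 ℕ.* a`, the form in which index 0 occurs in `denominator`; it
  -- computes to the `a + 0` of `φ-factor a 0`.
  φ-factor₀ : ∀ a → φ (1# - 𝐭 ^ a) ≈ 1# - 𝐭 ^ a * 𝐪 ^ (1 ℕ.* a)
  φ-factor₀ a = begin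
    φ (1# - 𝐭 ^ a)                 ≈⟨ φ-cong {1# - 𝐭 ^ a} {1# - 𝐭 ^ a * 𝐪 ^ 0} (+-congˡ {x = 1#}
                                        (-‿cong {𝐭 ^ a} {𝐭 ^ a * 𝐪 ^ 0}
                                          (sym {𝐭 ^ a * 𝐪 ^ 0} {𝐭 ^ a} (*-identityʳ (𝐭 ^ a))))) ⟩
    φ (1# - 𝐭 ^ a * 𝐪 ^ 0)         ≈⟨ φ-factor a 0 ⟩
    1# - 𝐭 ^ a * 𝐪 ^ (1 ℕ.* a)     ∎

  module Gaps (u v : ℕ) .{{_ : NonZero u}} .{{_ : NonZero v}} where

    -- The coefficient of t^l sums q^(l₁ + … + lₙ) over the admissible sequences with l₁ = l; since
    -- l₁ = l₂ + (l₁ − l₂), prepending a part is a product followed by t ↦ tq.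
    gapSeries : ∀ {m} → (Fin m → ℕ) → ℕ → Carrier
    gapSeries {zero}  d e = φ (X v e)
    gapSeries {suc m} d e = φ (gapSeries (d ∘ suc) e * X u (d zero))

    denominator : ℕ → Carrier
    denominator m = ∏[i< m ] (λ i → 1# - 𝐭 ^ u * 𝐪 ^ (suc i ℕ.* u)) * (1# - 𝐭 ^ v * 𝐪 ^ (suc m ℕ.* v))

    denominator-zero : denominator 0 ≈ φ (1# - 𝐭 ^ v)
    denominator-zero = begin
      1# * (1# - 𝐭 ^ v * 𝐪 ^ (1 ℕ.* v))  ≈⟨ *-identityˡ (1# - 𝐭 ^ v * 𝐪 ^ (1 ℕ.* v)) ⟩
      1# - 𝐭 ^ v * 𝐪 ^ (1 ℕ.* v)         ≈⟨ φ-factor₀ v ⟨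
      φ (1# - 𝐭 ^ v)                     ∎

    -- A prepended part brings the new factor `1 - t^u`. The substitution turns it into the first
    -- factor of the longer product and moves every old factor up by one index.
    denominator-suc : ∀ m → denominator (suc m) ≈ φ ((1# - 𝐭 ^ u) * denominator m)
    denominator-suc m = begin
      (f 0 * P₂) * Q₂         ≈⟨ *-assoc (f 0) P₂ Q₂ ⟩
      f 0 * (P₂ * Q₂)         ≈⟨ *-cong {f 0} {φ (1# - 𝐭 ^ u)} {P₂ * Q₂} {φ P₁ * φ Q₁} (sym {φ (1# - 𝐭 ^ u)} {f 0} (φ-factor₀ u))
                                   (*-cong {P₂} {φ P₁} {Q₂} {φ Q₁} (sym {φ P₁} {P₂} φP₁) (sym {φ Q₁} {Q₂} (φ-factor v (suc m ℕ.* v)))) ⟩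
      φ (1# - 𝐭 ^ u) * (φ P₁ * φ Q₁)  ≈⟨ *-congˡ {x = φ (1# - 𝐭 ^ u)} (φ-* P₁ Q₁) ⟨
      φ (1# - 𝐭 ^ u) * φ (P₁ * Q₁)    ≈⟨ φ-* (1# - 𝐭 ^ u) (P₁ * Q₁) ⟨
      φ ((1# - 𝐭 ^ u) * (P₁ * Q₁))    ∎
      where
      f : ℕ → Carrier
      f i = 1# - 𝐭 ^ u * 𝐪 ^ (suc i ℕ.* u)
      P₁ = product {m} (f ∘ toℕ)
      P₂ = product {m} (f ∘ suc ∘ toℕ)
      Q₁ = 1# - 𝐭 ^ v * 𝐪 ^ (suc m ℕ.* v)
      Q₂ = 1# - 𝐭 ^ v * 𝐪 ^ (suc (suc m) ℕ.* v)
      φP₁ : φ P₁ ≈ P₂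
      φP₁ = begin
        φ P₁                        ≈⟨ φ-product {m} (f ∘ toℕ) ⟩
        product {m} (φ ∘ f ∘ toℕ)   ≈⟨ product-cong {m} (λ i → φ-factor u (suc (toℕ i) ℕ.* u)) ⟩
        P₂                          ∎

    -- Since `φ` preserves products and 1, it maps an inverse to an inverse. Only `1 - t^u` and
    -- `1 - t^v` have to be inverted directly, by geometric series.
    denominator-unit : ∀ m → Unit (denominator m)
    denominator-unit zero    = unit-cong {φ (1# - 𝐭 ^ v)} {denominator 0}
      (sym {denominator 0} {φ (1# - 𝐭 ^ v)} denominator-zero) (φ-unit {1# - 𝐭 ^ v} (unit-1-t^ v))
    denominator-unit (suc m) = unit-cong {φ ((1# - 𝐭 ^ u) * denominator m)} {denominator (suc m)}
      (sym {denominator (suc m)} {φ ((1# - 𝐭 ^ u) * denominator m)} (denominator-suc m))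
      (φ-unit {(1# - 𝐭 ^ u) * denominator m} (unit-* {1# - 𝐭 ^ u} {denominator m} (unit-1-t^ u) (denominator-unit m)))

    -- Each geometric series cancels its factor and leaves t to the power of the least gap. If the
    -- later parts give `t^μ q^M`, the new first part is `d₀ + μ`, and `φ` adds exactly this number
    -- to the exponent of q.
    gapSeries-closed : ∀ {m} (d : Fin m → ℕ) e →
      gapSeries d e * denominator m ≈ 𝐭 ^ partSizes d e zero * 𝐪 ^ ℕΣ.sum (partSizes d e)
    gapSeries-closed {zero} d e = begin
      φ (X v e) * denominator 0     ≈⟨ *-congˡ {x = φ (X v e)} denominator-zero ⟩
      φ (X v e) * φ (1# - 𝐭 ^ v)    ≈⟨ φ-* (X v e) (1# - 𝐭 ^ v) ⟨
      φ (X v e * (1# - 𝐭 ^ v))      ≈⟨ φ-cong {X v e * (1# - 𝐭 ^ v)} {𝐭 ^ e} (geometric v e) ⟩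
      φ (𝐭 ^ e)                     ≈⟨ φ-cong {𝐭 ^ e} {𝐭 ^ e * 𝐪 ^ 0} (sym {𝐭 ^ e * 𝐪 ^ 0} {𝐭 ^ e} (*-identityʳ (𝐭 ^ e))) ⟩
      φ (𝐭 ^ e * 𝐪 ^ 0)             ≈⟨ φ-t^q^ e 0 ⟩
      𝐭 ^ e * 𝐪 ^ (e ℕ.+ 0)         ∎
    gapSeries-closed {suc m} d e = begin
      φ (H * Y) * denominator (suc m)         ≈⟨ *-congˡ {x = φ (H * Y)} (denominator-suc m) ⟩
      φ (H * Y) * φ (D₁ * D)                  ≈⟨ φ-* (H * Y) (D₁ * D) ⟨
      φ (H * Y * (D₁ * D))                    ≈⟨ φ-cong {H * Y * (D₁ * D)} {𝐭 ^ (d₀ ℕ.+ μ) * 𝐪 ^ M} body ⟩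
      φ (𝐭 ^ (d₀ ℕ.+ μ) * 𝐪 ^ M)              ≈⟨ φ-t^q^ (d₀ ℕ.+ μ) M ⟩
      𝐭 ^ (d₀ ℕ.+ μ) * 𝐪 ^ (d₀ ℕ.+ μ ℕ.+ M)   ∎
      where
      H  = gapSeries (d ∘ suc) e
      d₀ = d zero
      Y  = X u d₀
      D₁ = 1# - 𝐭 ^ u
      D  = denominator m
      μ  = partSizes (d ∘ suc) e zero
      M  = ℕΣ.sum (partSizes (d ∘ suc) e)
      body : H * Y * (D₁ * D) ≈ 𝐭 ^ (d₀ ℕ.+ μ) * 𝐪 ^ M
      body = begin
        H * Y * (D₁ * D)             ≈⟨ *-congʳ {x = D₁ * D} (*-comm H Y) ⟩
        Y * H * (D₁ * D)             ≈⟨ interchange Y H D₁ D ⟩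
        Y * D₁ * (H * D)             ≈⟨ *-cong {Y * D₁} {𝐭 ^ d₀} {H * D} {𝐭 ^ μ * 𝐪 ^ M} (geometric u d₀) (gapSeries-closed (d ∘ suc) e) ⟩
        𝐭 ^ d₀ * (𝐭 ^ μ * 𝐪 ^ M)     ≈⟨ *-assoc (𝐭 ^ d₀) (𝐭 ^ μ) (𝐪 ^ M) ⟨
        𝐭 ^ d₀ * 𝐭 ^ μ * 𝐪 ^ M       ≈⟨ *-congʳ {x = 𝐪 ^ M} (^-homo-* 𝐭 d₀ μ) ⟨
        𝐭 ^ (d₀ ℕ.+ μ) * 𝐪 ^ M       ∎

-- Sums over boxes

funToFin-cong : ∀ {n N} {f g : Fin n → Fin N} → f ≗ g → funToFin f ≡ funToFin g
funToFin-cong {zero}  e = ≡.refl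
funToFin-cong {suc n} e = ≡.cong₂ combine (e zero) (funToFin-cong (e ∘ suc))

finToFun-combine : ∀ {n N} (i : Fin N) (j : Fin (N ℕ.^ n)) → finToFun {N} {suc n} (combine i j) ≗ i ◂ finToFun j
finToFun-combine {n} {N} i j zero    = ≡.cong proj₁ (Finₚ.remQuot-combine {N} {N ℕ.^ n} i j)
finToFun-combine {n} {N} i j (suc k) = ≡.cong (λ p → finToFun (proj₂ p) k) (Finₚ.remQuot-combine {N} {N ℕ.^ n} i j)

module FunctionSums {c ℓ} (R : CommutativeRing c ℓ) where
  open CommutativeRing R hiding (zero)
  open SemiringSum semiring
  open SetoidReasoning setoid

  ∑ᶠ : ∀ n N → ((Fin n → Fin N) → Carrier) → Carrier
  ∑ᶠ n N F = sum {N ℕ.^ n} (F ∘ finToFun)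

  sum-↑ : ∀ m {n} (h : Fin (m ℕ.+ n) → Carrier) → sum h ≈ sum (h ∘ (_↑ˡ n)) + sum (h ∘ (m ↑ʳ_))
  sum-↑ zero    h = sym (+-identityˡ _)
  sum-↑ (suc m) h = trans (+-congˡ (sum-↑ m (h ∘ suc))) (sym (+-assoc _ _ _))

  sum-combine : ∀ N {M} (h : Fin (N ℕ.* M) → Carrier) → sum h ≈ sum {N} λ i → sum {M} λ j → h (combine i j)
  sum-combine zero        h = refl
  sum-combine (suc N) {M} h = trans (sum-↑ M h) (+-congˡ (sum-combine N (h ∘ (M ↑ʳ_))))

  sum-truncate : ∀ {a b} (w : ℕ → Carrier) → a ≤ b → (∀ i → a ≤ i → w i ≈ 0#) →
                 sum {b} (w ∘ toℕ) ≈ sum {a} (w ∘ toℕ)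
  sum-truncate {b = b} w z≤n       w≈0 = trans (sum-cong-≋ {b} λ i → w≈0 (toℕ i) z≤n) (sum-replicate-zero b)
  sum-truncate         w (s≤s a≤b) w≈0 = +-congˡ (sum-truncate (w ∘ suc) a≤b λ i a≤i → w≈0 (suc i) (s≤s a≤i))

  ∑ᶠ-cong : ∀ n N {F G} → (∀ f → F f ≈ G f) → ∑ᶠ n N F ≈ ∑ᶠ n N G
  ∑ᶠ-cong n N e = sum-cong-≋ {N ℕ.^ n} (e ∘ finToFun)

  ∑ᶠ-*ˡ : ∀ n N a F → a * ∑ᶠ n N F ≈ ∑ᶠ n N (λ f → a * F f)
  ∑ᶠ-*ˡ n N a F = *-distribˡ-sum {N ℕ.^ n} a (F ∘ finToFun)

  -- Sums over functions run over their codes, and decoding reproduces a given function only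
  -- pointwise. A summand must respect this before the sum can be split or reindexed.
  Extensional : ∀ {n N} → ((Fin n → Fin N) → Carrier) → Set _
  Extensional F = ∀ {f g} → f ≗ g → F f ≈ F g

  ∑ᶠ-suc : ∀ n N F → Extensional F → ∑ᶠ (suc n) N F ≈ sum λ i → ∑ᶠ n N λ f → F (i ◂ f)
  ∑ᶠ-suc n N F ext = trans (sum-combine N (F ∘ finToFun))
    (sum-cong-≋ {N} λ i → sum-cong-≋ {N ℕ.^ n} λ j → ext (finToFun-combine i j))

  ∑ᶠ-permute : ∀ n N F → Extensional F → (σ : Permutation′ n) →
               ∑ᶠ n N F ≈ ∑ᶠ n N λ f → F (f ∘ (σ ⟨$⟩ʳ_))
  ∑ᶠ-permute n N F ext σ = trans (sum-permute (F ∘ finToFun) π)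
    (sum-cong-≋ {N ℕ.^ n} λ i → ext (Finₚ.finToFun-funToFin (finToFun i ∘ (σ ⟨$⟩ʳ_))))
    where
    reindex : (Fin n → Fin n) → Fin (N ℕ.^ n) → Fin (N ℕ.^ n)
    reindex τ i = funToFin (finToFun i ∘ τ)

    reindex-inverse : ∀ {τ τ′} → (∀ i → τ′ (τ i) ≡ i) → ∀ i → reindex τ (reindex τ′ i) ≡ i
    reindex-inverse {τ} {τ′} e i = ≡.trans
      (funToFin-cong λ k → ≡.trans (Finₚ.finToFun-funToFin (finToFun i ∘ τ′) (τ k)) (≡.cong (finToFun i) (e k)))
      (Finₚ.funToFin-finToFin {n} i)

    π : Permutation′ (N ℕ.^ n)
    π = permutation (reindex (σ ⟨$⟩ʳ_)) (reindex (σ ⟨$⟩ˡ_))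
      (reindex-inverse λ _ → inverseˡ σ) (reindex-inverse λ _ → inverseʳ σ)

size : ∀ {n N} → (Fin n → Fin N) → ℕ
size f = ℕΣ.sum (toℕ ∘ f)

Gap : (u d l l′ : ℕ) → Set
Gap u d l l′ = l′ ≤ l × Reach u d (l ∸ l′)

gap? : ∀ u d l l′ → Dec (Gap u d l l′)
gap? u d l l′ = (l′ ℕₚ.≤? l) ×-dec reach? u d (l ∸ l′)

Admissible : (u v : ℕ) → ∀ {m} → (Fin m → ℕ) → ℕ → (Fin (suc m) → ℕ) → Set
Admissible u v {zero}  d e l = Reach v e (l zero)
Admissible u v {suc m} d e l = Gap u (d zero) (l zero) (l (suc zero)) × Admissible u v (d ∘ suc) e (l ∘ suc)

admissible? : ∀ u v {m} (d : Fin m → ℕ) e l → Dec (Admissible u v d e l)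
admissible? u v {zero}  d e l = reach? v e (l zero)
admissible? u v {suc m} d e l = gap? u (d zero) (l zero) (l (suc zero)) ×-dec admissible? u v (d ∘ suc) e (l ∘ suc)

admissible-cong : ∀ u v {m} (d : Fin m → ℕ) e {l l′} → l ≗ l′ → Admissible u v d e l → Admissible u v d e l′
admissible-cong u v {zero}  d e l≗l′ = ≡.subst (Reach v e) (l≗l′ zero)
admissible-cong u v {suc m} d e l≗l′ (g , a) =
  ≡.subst₂ (Gap u (d zero)) (l≗l′ zero) (l≗l′ (suc zero)) g , admissible-cong u v (d ∘ suc) e (l≗l′ ∘ suc) a

module AdmissibleSums {c ℓ} (R : CommutativeRing c ℓ) (x : CommutativeRing.Carrier R) where
  open CommutativeRing R hiding (zero; _-_)
  open RingNotation rawRing using (_^_; [_]_)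
  open SemiringSum semiring
  open SemiringExp semiring using (^-homo-*; ^-congʳ)
  open Indicator R
  open FunctionSums R
  open CommutativeSemigroupProperties *-commutativeSemigroup using (interchange)
  open SetoidReasoning setoid
  open GapSeries R x using (X; module Gaps)
  private module S = RingNotation (PowerSeries rawRing)

  monomial : ∀ {n N} → (Fin n → Fin N) → Carrier
  monomial f = x ^ size f

  monomial-cong : ∀ {n N} → Extensional {n} {N} monomial
  monomial-cong f≗g = ^-congʳ x (ℕΣ.sum-cong-≗ (≡.cong toℕ ∘ f≗g))

  box : ∀ n N → ([ N ] x) ^ n ≈ ∑ᶠ n N monomial
  box zero    N = sym (+-identityʳ 1#)
  box (suc n) N = begin
    [ N ] x * ([ N ] x) ^ n                          ≈⟨ *-congˡ (box n N) ⟩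
    [ N ] x * ∑ᶠ n N monomial                        ≈⟨ *-distribʳ-sum {N} (∑ᶠ n N monomial) (λ i → x ^ toℕ i) ⟩
    sum {N} (λ i → x ^ toℕ i * ∑ᶠ n N monomial)
      ≈⟨ (sum-cong-≋ {N} λ i → trans (∑ᶠ-*ˡ n N (x ^ toℕ i) monomial)
           (∑ᶠ-cong n N λ f → sym (^-homo-* x (toℕ i) (size f)))) ⟩
    sum {N} (λ i → ∑ᶠ n N λ f → monomial (i ◂ f))    ≈⟨ ∑ᶠ-suc n N monomial monomial-cong ⟨
    ∑ᶠ (suc n) N monomial                            ∎

  module _ (u v : ℕ) .{{_ : NonZero u}} .{{_ : NonZero v}} where
    open Gaps u v

    weight : ∀ {m N} → (Fin m → ℕ) → ℕ → (Fin (suc m) → Fin N) → Carrier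
    weight d e f = 𝟙 (admissible? u v d e (toℕ ∘ f)) * monomial f

    weight-cong : ∀ {m N} (d : Fin m → ℕ) e → Extensional {suc m} {N} (weight d e)
    weight-cong d e f≗g = *-cong
      (𝟙-cong (admissible? u v d e _) (admissible? u v d e _)
        (mk⇔ (admissible-cong u v d e (≡.cong toℕ ∘ f≗g)) (admissible-cong u v d e (≡.cong toℕ ∘ ≡.sym ∘ f≗g))))
      (monomial-cong f≗g)

    -- Next parts larger than `l` violate the gap condition, so the bound `K` of the box disappears
    -- and the sum stops at `l`, as in a product of series.
    gap-convolution : ∀ K d H l → l ℕ.< suc K →
      sum {suc K} (λ i → 𝟙 (gap? u d l (toℕ i)) * H (toℕ i)) ≈ (H S.* X u d) l
    gap-convolution K d H l l<N = trans
      (sum-truncate {suc l} {suc K} (λ i → 𝟙 (gap? u d l i) * H i) l<N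
        λ i l<i → trans (*-congʳ (𝟙-false (gap? u d l i) λ (i≤l , _) → ℕₚ.<⇒≱ l<i i≤l)) (zeroˡ _))
      (sum-cong-≋ {suc l} λ i → trans (*-congʳ (𝟙-cong (gap? u d l (toℕ i)) (reach? u d (l ∸ toℕ i))
        (mk⇔ proj₂ (ℕₚ.≤-pred (Finₚ.toℕ<n i) ,_)))) (*-comm _ (H (toℕ i))))

    -- Admissible sequences decrease, so once the first part lies in the box, all parts do. Peeling
    -- off the next part `i` reproduces the two operations of `gapSeries`: the sum over `i` is the
    -- product with `X`, and the factor `x ^ toℕ l` is the effect of `φ`.
    weight-head : ∀ {m} K (d : Fin m → ℕ) e (l : Fin (suc K)) →
      ∑ᶠ m (suc K) (λ f → weight d e (l ◂ f)) ≈ gapSeries d e (toℕ l)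
    weight-head {zero} K d e l = trans (+-identityʳ _) (trans (*-comm _ _) (*-congʳ (^-congʳ x (ℕₚ.+-identityʳ (toℕ l)))))
    weight-head {suc m} K d e l = begin
      ∑ᶠ (suc m) N (λ f → weight d e (l ◂ f))
        ≈⟨ ∑ᶠ-suc m N (λ f → weight d e (l ◂ f))
             (λ {f} {g} f≗g → weight-cong d e {l ◂ f} {l ◂ g} (λ { zero → ≡.refl ; (suc i) → f≗g i })) ⟩
      sum {N} (λ i → ∑ᶠ m N λ f → weight d e (l ◂ i ◂ f))
        ≈⟨ (sum-cong-≋ {N} λ i → trans (∑ᶠ-cong m N (split i))
             (trans (sym (∑ᶠ-*ˡ m N (x ^ toℕ l * 𝟙 (gap? u (d zero) (toℕ l) (toℕ i))) (λ f → weight (d ∘ suc) e (i ◂ f))))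
             (trans (*-congˡ (weight-head K (d ∘ suc) e i)) (*-assoc _ _ _)))) ⟩
      sum {N} (λ i → x ^ toℕ l * (𝟙 (gap? u (d zero) (toℕ l) (toℕ i)) * H (toℕ i)))
        ≈⟨ *-distribˡ-sum {N} (x ^ toℕ l) (λ i → 𝟙 (gap? u (d zero) (toℕ l) (toℕ i)) * H (toℕ i)) ⟨
      x ^ toℕ l * sum {N} (λ i → 𝟙 (gap? u (d zero) (toℕ l) (toℕ i)) * H (toℕ i))
        ≈⟨ *-congˡ (gap-convolution K (d zero) H (toℕ l) (Finₚ.toℕ<n l)) ⟩
      gapSeries d e (toℕ l) ∎
      where
      N = suc K
      H = gapSeries (d ∘ suc) e
      split : ∀ i f → weight d e (l ◂ i ◂ f) ≈
              x ^ toℕ l * 𝟙 (gap? u (d zero) (toℕ l) (toℕ i)) * weight (d ∘ suc) e (i ◂ f)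
      split i f = begin
        𝟙 (g? ×-dec a?) * x ^ (toℕ l ℕ.+ size (i ◂ f))    ≈⟨ *-cong (𝟙-× g? a?) (^-homo-* x (toℕ l) (size (i ◂ f))) ⟩
        𝟙 g? * 𝟙 a? * (x ^ toℕ l * monomial (i ◂ f))      ≈⟨ interchange _ _ _ _ ⟩
        𝟙 g? * x ^ toℕ l * (𝟙 a? * monomial (i ◂ f))      ≈⟨ *-congʳ (*-comm _ _) ⟩
        x ^ toℕ l * 𝟙 g? * weight (d ∘ suc) e (i ◂ f)     ∎
        where
        g? = gap? u (d zero) (toℕ l) (toℕ i)
        a? = admissible? u v (d ∘ suc) e (toℕ ∘ (i ◂ f))

    weight-sum : ∀ {m} K (d : Fin m → ℕ) e → ∑ᶠ (suc m) (suc K) (weight d e) ≈ (gapSeries d e S.* X 1 0) K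
    weight-sum {m} K d e = trans (∑ᶠ-suc m (suc K) (weight d e) (weight-cong d e))
      -- All coefficients of `X 1 0` are 1, because 1 divides every difference. Hence the
      -- convolution just adds up the first parts from 0 to `K`.
      (sum-cong-≋ {suc K} λ i → trans (weight-head K d e i)
        (sym (trans (*-congˡ (𝟙-true (reach? 1 0 (K ∸ toℕ i)) (z≤n , 1∣ _))) (*-identityʳ _))))

-- Sums and indicators over lists

module ListSums {c ℓ} (R : CommutativeRing c ℓ) where
  open CommutativeRing R hiding (zero)
  open RingNotation rawRing using (∑-list)
  open SemiringSum semiring using (sum; sum-replicate-zero; ∑-distrib-+)
  open Indicator R

  ∑-list-cong : ∀ {b} {B : Set b} (xs : List B) {F G : B → Carrier} → (∀ x → F x ≈ G x) → ∑-list xs F ≈ ∑-list xs G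
  ∑-list-cong []       e = refl
  ∑-list-cong (x ∷ xs) e = +-cong (e x) (∑-list-cong xs e)

  ∑-list-*ʳ : ∀ {b} {B : Set b} (xs : List B) F a → ∑-list xs F * a ≈ ∑-list xs (λ x → F x * a)
  ∑-list-*ʳ []       F a = zeroˡ a
  ∑-list-*ʳ (x ∷ xs) F a = trans (distribʳ a _ _) (+-congˡ (∑-list-*ʳ xs F a))

  ∑-list-swap : ∀ {b} {B : Set b} (xs : List B) N (F : B → Fin N → Carrier) →
                sum {N} (λ i → ∑-list xs λ x → F x i) ≈ ∑-list xs λ x → sum {N} (F x)
  ∑-list-swap []       N F = sum-replicate-zero N
  ∑-list-swap (x ∷ xs) N F = trans (∑-distrib-+ {N} (F x) _) (+-congˡ (∑-list-swap xs N F))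

  module _ {b ℓ} {B : Set b} {P : B → Set ℓ} (P? : ∀ x → Dec (P x)) where

    ∑-𝟙-none : ∀ {xs} → All (¬_ ∘ P) xs → ∑-list xs (𝟙 ∘ P?) ≈ 0#
    ∑-𝟙-none []         = refl
    ∑-𝟙-none (¬p ∷ ¬ps) = trans (+-cong (𝟙-false (P? _) ¬p) (∑-𝟙-none ¬ps)) (+-identityʳ 0#)

    ∑-𝟙-one : ∀ {xs} → AllPairs (λ x y → ¬ (P x × P y)) xs → Any P xs → ∑-list xs (𝟙 ∘ P?) ≈ 1#
    ∑-𝟙-one (excl ∷ _) (here p)  = trans
      (+-cong (𝟙-true (P? _) p) (∑-𝟙-none (All.map (λ ¬both q → ¬both (p , q)) excl))) (+-identityʳ 1#)
    ∑-𝟙-one (excl ∷ u) (there a) = trans (+-cong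
      (𝟙-false (P? _) λ p → Allₚ.Any¬⇒¬All (Any.map (λ q ¬both → ¬both (p , q)) a) excl)
      (∑-𝟙-one u a)) (+-identityˡ 1#)

-- Terms whose degree in q is divisible by p

ℤ⟦q⟧ᶜ ℤ⟦q⟧⟦t⟧ᶜ : CommutativeRing _ _
ℤ⟦q⟧ᶜ    = PowerSeriesRing.powerSeriesRing ℤₚ.+-*-commutativeRing
ℤ⟦q⟧⟦t⟧ᶜ = PowerSeriesRing.powerSeriesRing ℤ⟦q⟧ᶜ

module _ where
  open CommutativeRing ℤ⟦q⟧ᶜ hiding (zero)
  open SemiringSum semiring using (sum)
  open Indicator ℤ⟦q⟧ᶜ
  -- Over `ℤ` the series variable `𝐭` of this module is `q₁`, so `𝐭^-*` says that multiplication by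
  -- a power of `q₁` shifts coefficients. The value `1ℤ` is a placeholder.
  open GapSeries ℤₚ.+-*-commutativeRing ℤ.1ℤ using () renaming (shift to shiftᶻ; 𝐭^-* to q^-*)

  keep : ℕ → Carrier → Carrier
  keep p a j = if does (p ∣? j) then a j else 0ℤ

  keep-cong : ∀ p {a b} → a ≈ b → keep p a ≈ keep p b
  keep-cong p e j with does (p ∣? j)
  ... | true  = e j
  ... | false = ≡.refl

  keep-sum : ∀ p N (F : Fin N → Carrier) → keep p (sum F) ≈ sum (keep p ∘ F)
  keep-sum p zero    F j with does (p ∣? j)
  ... | true  = ≡.refl
  ... | false = ≡.refl
  keep-sum p (suc N) F j = ≡.trans (keep-+ j) (≡.cong (ℤ._+_ (keep p (F zero) j)) (keep-sum p N (F ∘ suc) j))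
    where
    keep-+ : keep p (F zero + sum (F ∘ suc)) ≈ keep p (F zero) + keep p (sum (F ∘ suc))
    keep-+ j with does (p ∣? j)
    ... | true  = ≡.refl
    ... | false = ≡.refl

  q₁^-coefficient : ∀ {a j} → a ≢ j → (q₁ ℤ⟦q⟧.^ a) j ≡ 0ℤ
  q₁^-coefficient {a} {j} a≢j =
    ≡.trans (sym (*-identityʳ (q₁ ℤ⟦q⟧.^ a)) j) (≡.trans (q^-* a 1# j) (shift-1# a j a≢j))
    where
    shift-1# : ∀ a j → a ≢ j → shiftᶻ a 1# j ≡ 0ℤ
    shift-1# zero    zero    a≢j = contradiction ≡.refl a≢j
    shift-1# zero    (suc j) a≢j = ≡.refl
    shift-1# (suc a) zero    a≢j = ≡.refl
    shift-1# (suc a) (suc j) a≢j = shift-1# a j (a≢j ∘ ≡.cong suc)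

  keep-q^ : ∀ p a → keep p (q₁ ℤ⟦q⟧.^ a) ≈ 𝟙 (p ∣? a) * q₁ ℤ⟦q⟧.^ a
  keep-q^ p a with p ∣? a
  ... | yes p∣a = λ j → ≡.trans (kept j) (sym (*-identityˡ (q₁ ℤ⟦q⟧.^ a)) j)
    where
    kept : keep p (q₁ ℤ⟦q⟧.^ a) ≈ q₁ ℤ⟦q⟧.^ a
    kept j with p ∣? j
    ... | yes _   = ≡.refl
    ... | no ¬p∣j = ≡.sym (q₁^-coefficient {a} {j} λ { ≡.refl → ¬p∣j p∣a })
  ... | no ¬p∣a = λ j → ≡.trans (dropped j) (sym (zeroˡ (q₁ ℤ⟦q⟧.^ a)) j)
    where
    dropped : keep p (q₁ ℤ⟦q⟧.^ a) ≈ 0#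
    dropped j with p ∣? j
    ... | no _    = ≡.refl
    ... | yes p∣j = q₁^-coefficient {a} {j} λ { ≡.refl → ¬p∣a p∣j }

-- Arithmetic with inverses, and coefficients of list sums

module Quotients {c ℓ} (R : CommutativeRing c ℓ) where
  open CommutativeRing R
  open CommutativeSemigroupProperties *-commutativeSemigroup using (interchange)
  open SetoidReasoning setoid

  *-split : ∀ {h d n e} x → h * d ≈ n → d * e ≈ 1# → h * x ≈ n * (x * e)
  *-split {h} {d} {n} {e} x hd≈n de≈1 = begin
    h * x              ≈⟨ *-identityʳ (h * x) ⟨
    h * x * 1#         ≈⟨ *-congˡ de≈1 ⟨
    h * x * (d * e)    ≈⟨ interchange h x d e ⟩
    h * d * (x * e)    ≈⟨ *-congʳ hd≈n ⟩
    n * (x * e)        ∎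

  *-inverses : ∀ u x a b e → u * x ≈ 1# → a * b * e ≈ 1# → u * a * b * (x * e) ≈ 1#
  *-inverses u x a b e ux≈1 abe≈1 = begin
    u * a * b * (x * e)      ≈⟨ *-congʳ (*-assoc u a b) ⟩
    u * (a * b) * (x * e)    ≈⟨ interchange u (a * b) x e ⟩
    u * x * (a * b * e)      ≈⟨ *-cong ux≈1 abe≈1 ⟩
    1# * 1#                  ≈⟨ *-identityˡ 1# ⟩
    1#                       ∎

∑-list-coefficient : ∀ {b} {B : Set b} (xs : List B) (F : B → ℤ⟦q⟧⟦t⟧.Carrier) K →
                     ℤ⟦q⟧⟦t⟧.∑-list xs F K ≡ ℤ⟦q⟧.∑-list xs λ x → F x K
∑-list-coefficient []       F K = ≡.refl
∑-list-coefficient (x ∷ xs) F K = ≡.cong (ℤ⟦q⟧._+_ (F x K)) (∑-list-coefficient xs F K)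

-- Sorting a function and its coloured permutation

module Combinatorics where
  open ≡
  open import Data.Nat.Base using (_+_; _*_)
  open import Data.Nat.DivMod using (_%_; _/_; _mod_; m≡m%n+[m/n]*n; [m+kn]%n≡m%n; m<n⇒m%n≡m; m%n≤m)
  open import Data.Fin.Subset using (_∈_)
  open ColoredPermutation

  -- Congruences between natural numbers

  infix 4 _≡_[mod_]
  -- A multiple on either side keeps the relation symmetric and avoids subtraction.
  _≡_[mod_] : ℕ → ℕ → ℕ → Set
  a ≡ b [mod n ] = ∃₂ λ x y → a + x * n ≡ b + y * n

  module _ {n : ℕ} where

    mod-refl : ∀ {a} → a ≡ a [mod n ]
    mod-refl = 0 , 0 , refl

    mod-sym : ∀ {a b} → a ≡ b [mod n ] → b ≡ a [mod n ]
    mod-sym (x , y , e) = y , x , sym e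

    mod-trans : ∀ {a b c} → a ≡ b [mod n ] → b ≡ c [mod n ] → a ≡ c [mod n ]
    mod-trans {a} {b} {c} (x , y , e) (x′ , y′ , e′) = x + x′ , y′ + y , (begin
      a + (x + x′) * n      ≡⟨ split a x x′ n ⟩
      (a + x * n) + x′ * n  ≡⟨ cong (_+ x′ * n) e ⟩
      (b + y * n) + x′ * n  ≡⟨ exchange b y x′ n ⟩
      (b + x′ * n) + y * n  ≡⟨ cong (_+ y * n) e′ ⟩
      (c + y′ * n) + y * n  ≡⟨ split c y′ y n ⟨
      c + (y′ + y) * n      ∎)
      where
      open ≡-Reasoning
      split : ∀ a x x′ n → a + (x + x′) * n ≡ (a + x * n) + x′ * n
      split = solve-∀
      exchange : ∀ b y x′ n → (b + y * n) + x′ * n ≡ (b + x′ * n) + y * n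
      exchange = solve-∀

    +-cong-mod : ∀ {a b c d} → a ≡ b [mod n ] → c ≡ d [mod n ] → a + c ≡ b + d [mod n ]
    +-cong-mod {a} {b} {c} {d} (x , y , e) (x′ , y′ , e′) = x + x′ , y + y′ ,
      trans (merge a x c x′ n) (trans (cong₂ _+_ e e′) (sym (merge b y d y′ n)))
      where
      merge : ∀ a x c x′ n → a + c + (x + x′) * n ≡ (a + x * n) + (c + x′ * n)
      merge = solve-∀

    mod-cancelʳ : ∀ c {a b} → a + c ≡ b + c [mod n ] → a ≡ b [mod n ]
    mod-cancelʳ c {a} {b} (x , y , e) = x , y , ℕₚ.+-cancelʳ-≡ c (a + x * n) (b + y * n)
      (trans (exchange a x c n) (trans e (sym (exchange b y c n))))
      where
      exchange : ∀ a x c n → a + x * n + c ≡ a + c + x * n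
      exchange = solve-∀

    mod-multiple : ∀ a k → a + k * n ≡ a [mod n ]
    mod-multiple a k = 0 , k , ℕₚ.+-identityʳ (a + k * n)

    mod-∣ : ∀ {p a b} → p ∣ n → a ≡ b [mod n ] → p ∣ a → p ∣ b
    mod-∣ {p} {a} {b} p∣n (x , y , e) p∣a = ∣m+n∣m⇒∣n {p} {y * n} {b}
      (subst (p ∣_) (trans e (ℕₚ.+-comm b (y * n))) (∣m∣n⇒∣m+n p∣a (∣n⇒∣m*n x p∣n))) (∣n⇒∣m*n y p∣n)

    mod-weaken : ∀ {m a b} → m ∣ n → a ≡ b [mod n ] → a ≡ b [mod m ]
    mod-weaken {m} {a} {b} (divides k n≡km) (x , y , e) = x * k , y * k ,
      trans (cong (a +_) (expand x)) (trans e (cong (b +_) (sym (expand y))))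
      where
      expand : ∀ z → z * k * m ≡ z * n
      expand z = trans (ℕₚ.*-assoc z k m) (cong (z *_) (sym n≡km))

    mod-% : ∀ a .{{_ : NonZero n}} → a % n ≡ a [mod n ]
    mod-% a = mod-sym (0 , a / n , trans (ℕₚ.+-identityʳ a) (m≡m%n+[m/n]*n a n))

    mod⇒% : ∀ {a b} .{{_ : NonZero n}} → a ≡ b [mod n ] → a % n ≡ b % n
    mod⇒% {a} {b} (x , y , e) = trans (sym ([m+kn]%n≡m%n a x n)) (trans (cong (_% n) e) ([m+kn]%n≡m%n b y n))

  -- The sorting permutation of a strict total order

  injective⇒surjective : ∀ {n} {f : Fin n → Fin n} → Injective _≡_ _≡_ f → ∀ i → ∃ λ j → f j ≡ i
  injective⇒surjective {suc n} {f} inj i with Finₚ.any? (λ j → f j Finₚ.≟ i)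
  ... | yes found = found
  -- A missed value could be punched out of the codomain, leaving an injection from `Fin (suc n)`
  -- into `Fin n`.
  ... | no missed = contradiction
    (Finₚ.injective⇒≤ λ {j} {k} e → inj (Finₚ.punchOut-injective (avoids j) (avoids k) e)) ℕₚ.1+n≰n
    where
    avoids : ∀ j → i ≢ f j
    avoids j e = missed (j , sym e)

  strictlyMonotone⇒inflationary : ∀ {n} (φ : Fin n → Fin n) → (∀ {i j} → i Fin.< j → φ i Fin.< φ j) →
                                  ∀ i → i Fin.≤ φ i
  strictlyMonotone⇒inflationary {n} φ mono i = go (toℕ i) i refl
    where
    go : ∀ k (i : Fin n) → toℕ i ≡ k → k ≤ toℕ (φ i)
    go zero    i       _ = ℕ.z≤n
    go (suc k) (suc i) e = ℕₚ.≤-<-trans (go k (inject₁ i) (trans (Finₚ.toℕ-inject₁ i) (ℕₚ.suc-injective e)))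
      (mono (ℕₚ.≤-reflexive (cong suc (Finₚ.toℕ-inject₁ i))))

  consecutive⇒monotone : ∀ {a ℓ} {A : Set a} {_≺_ : Rel A ℓ} → Transitive _≺_ → ∀ {m} {x : Fin (suc m) → A} →
    (∀ i → x (inject₁ i) ≺ x (suc i)) → ∀ {i j} → i Fin.< j → x i ≺ x j
  consecutive⇒monotone {_≺_ = _≺_} ≺-trans {suc m} {x} step {zero}  {suc zero}    _   = step zero
  consecutive⇒monotone {_≺_ = _≺_} ≺-trans {suc m} {x} step {zero}  {suc (suc j)} _   =
    ≺-trans (step zero) (consecutive⇒monotone {_≺_ = _≺_} ≺-trans {x = x ∘ suc} (step ∘ suc) {zero} {suc j} z<s)
  consecutive⇒monotone {_≺_ = _≺_} ≺-trans {suc m} {x} step {suc i} {suc j}       i<j =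
    consecutive⇒monotone {_≺_ = _≺_} ≺-trans {x = x ∘ suc} (step ∘ suc) (s<s⁻¹ i<j)

  module Sorting {n : ℕ} {_≺_ : Rel (Fin n) 0ℓ} (isSTO : IsStrictTotalOrder _≡_ _≺_) where
    open IsStrictTotalOrder isSTO using (compare; irrefl; _<?_) renaming (trans to ≺-trans)

    Sorts : (Fin n → Fin n) → Set
    Sorts σ = ∀ {i j} → i Fin.< j → σ i ≺ σ j

    below : Fin n → Subset n
    below a = Vec.tabulate λ b → does (b <? a)

    ∈-below⁺ : ∀ {a b} → b ≺ a → b ∈ below a
    ∈-below⁺ {a} {b} b≺a = lookup⇒[]= b (below a) (trans (lookup∘tabulate _ b) (dec-true (b <? a) b≺a))

    ∈-below⁻ : ∀ {a b} → b ∈ below a → b ≺ a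
    ∈-below⁻ {a} {b} b∈ with b <? a | trans (sym (lookup∘tabulate (λ b → does (b <? a)) b)) ([]=⇒lookup b∈)
    ... | yes b≺a | _ = b≺a

    -- The number of smaller elements is the position in the sorted order, so the sorting
    -- permutation is the inverse of this map. Strict inclusion of the sets `below` makes it
    -- strictly monotone and hence injective.
    rank : Fin n → Fin n
    rank a = fromℕ< (subst (∣ below a ∣ ℕ.<_) (∣⊤∣≡n n)
      (p⊂q⇒∣p∣<∣q∣ ((λ _ → ∈⊤) , a , ∈⊤ , λ a∈ → irrefl refl (∈-below⁻ a∈))))

    rank-mono : ∀ {a b} → a ≺ b → rank a Fin.< rank b
    rank-mono {a} {b} a≺b = subst₂ ℕ._<_ (sym (Finₚ.toℕ-fromℕ< _)) (sym (Finₚ.toℕ-fromℕ< _))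
      (p⊂q⇒∣p∣<∣q∣ ((λ c∈ → ∈-below⁺ (≺-trans (∈-below⁻ c∈) a≺b)) , a , ∈-below⁺ a≺b , λ a∈ → irrefl refl (∈-below⁻ a∈)))

    rank-injective : Injective _≡_ _≡_ rank
    rank-injective {a} {b} e with compare a b
    ... | tri≈ _ a≡b _ = a≡b
    ... | tri< a≺b _ _ = contradiction (rank-mono a≺b) (ℕₚ.<-irrefl (cong toℕ e))
    ... | tri> _ _ b≺a = contradiction (rank-mono b≺a) (ℕₚ.<-irrefl (cong toℕ (sym e)))

    sorting : Permutation′ n
    sorting = permutation (λ i → proj₁ (surj i)) rank
      (λ i → rank-injective (proj₂ (surj (rank i)))) (λ i → proj₂ (surj i))
      where
      surj = injective⇒surjective rank-injective

    sorting-sorts : Sorts (sorting ⟨$⟩ʳ_)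
    sorting-sorts {i} {j} i<j with compare (sorting ⟨$⟩ʳ i) (sorting ⟨$⟩ʳ j)
    ... | tri< σi≺σj _ _ = σi≺σj
    ... | tri≈ _ σi≡σj _ = contradiction i<j
      (ℕₚ.<-irrefl (cong toℕ (trans (sym (inverseˡ sorting)) (trans (cong rank σi≡σj) (inverseˡ sorting)))))
    ... | tri> _ _ σj≺σi = contradiction i<j
      (ℕₚ.<-asym (subst₂ Fin._<_ (inverseˡ sorting) (inverseˡ sorting) (rank-mono σj≺σi)))

    -- The composite τ⁻¹σ is strictly monotone on positions, so it never moves a position down. With
    -- σ and τ exchanged the same holds for its inverse, and `sorts-unique` concludes that it is the
    -- identity.
    sorts⇒≤ : ∀ (σ τ : Permutation′ n) → Sorts (σ ⟨$⟩ʳ_) → Sorts (τ ⟨$⟩ʳ_) →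
              ∀ i → i Fin.≤ (τ ⟨$⟩ˡ (σ ⟨$⟩ʳ i))
    sorts⇒≤ σ τ σ-sorts τ-sorts = strictlyMonotone⇒inflationary _ mono
      where
      mono : ∀ {i j} → i Fin.< j → (τ ⟨$⟩ˡ (σ ⟨$⟩ʳ i)) Fin.< (τ ⟨$⟩ˡ (σ ⟨$⟩ʳ j))
      mono {i} {j} i<j with Finₚ.<-cmp (τ ⟨$⟩ˡ (σ ⟨$⟩ʳ i)) (τ ⟨$⟩ˡ (σ ⟨$⟩ʳ j))
      ... | tri< lt _ _ = lt
      ... | tri≈ _ eq _ = contradiction (σ-sorts i<j)
        (irrefl (trans (sym (inverseʳ τ)) (trans (cong (τ ⟨$⟩ʳ_) eq) (inverseʳ τ))))
      ... | tri> _ _ gt = contradiction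
        (≺-trans (σ-sorts i<j) (subst₂ _≺_ (inverseʳ τ) (inverseʳ τ) (τ-sorts gt))) (irrefl refl)

    sorts-unique : ∀ (σ τ : Permutation′ n) → Sorts (σ ⟨$⟩ʳ_) → Sorts (τ ⟨$⟩ʳ_) → ∀ i → σ ⟨$⟩ʳ i ≡ τ ⟨$⟩ʳ i
    sorts-unique σ τ σ-sorts τ-sorts i = trans (sym (inverseʳ τ)) (cong (τ ⟨$⟩ʳ_) (sym i≡τ⁻¹σi))
      where
      i≡τ⁻¹σi : i ≡ τ ⟨$⟩ˡ (σ ⟨$⟩ʳ i)
      i≡τ⁻¹σi = Finₚ.≤-antisym (sorts⇒≤ σ τ σ-sorts τ-sorts i)
        (subst ((τ ⟨$⟩ˡ (σ ⟨$⟩ʳ i)) Fin.≤_)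
          (trans (cong (σ ⟨$⟩ˡ_) (inverseʳ τ)) (inverseˡ σ))
          (sorts⇒≤ τ σ τ-sorts σ-sorts (τ ⟨$⟩ˡ (σ ⟨$⟩ʳ i))))

  -- Ties are broken from left to right, so that equal values never form a descent.
  infix 4 _⊢_≺_
  _⊢_≺_ : ∀ {n} → (Fin n → ℕ) → Rel (Fin n) 0ℓ
  l ⊢ a ≺ b = ×-Lex _≡_ ℕ._>_ Fin._<_ (l a , a) (l b , b)

  ≺-isStrictTotalOrder : ∀ {n} (l : Fin n → ℕ) → IsStrictTotalOrder _≡_ (l ⊢_≺_)
  ≺-isStrictTotalOrder l = isStrictTotalOrderᶜ record
    { isEquivalence = isEquivalence
    ; trans = ×-transitive {_<₁_ = ℕ._>_} {_<₂_ = Fin._<_} isEquivalence (resp₂ ℕ._>_) (λ a>b b>c → ℕₚ.<-trans b>c a>b) Finₚ.<-trans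
    ; compare = compare
    }
    where
    compare : Trichotomous _≡_ (l ⊢_≺_)
    compare a b with ×-compare {_<₁_ = ℕ._>_} {_<₂_ = Fin._<_} sym >-cmp Finₚ.<-cmp (l a , a) (l b , b)
      where
      >-cmp : Trichotomous _≡_ ℕ._>_
      >-cmp x y with ℕₚ.<-cmp x y
      ... | tri< a b c = tri> c b a
      ... | tri≈ a b c = tri≈ c b a
      ... | tri> a b c = tri< c b a
    ... | tri< lt ne gt = tri< lt (λ { refl → ne (refl , refl) }) gt
    ... | tri≈ lt eq gt = tri≈ lt (proj₂ eq) gt
    ... | tri> lt ne gt = tri> lt (λ { refl → ne (refl , refl) }) gt

  -- Descent counts and admissibility, position by position

  [_]₀₁ : ∀ {a} {A : Set a} → Dec A → ℕ
  [ A? ]₀₁ = if does A? then 1 else 0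

  length-filter-tabulate : ∀ {a ℓ} {A : Set a} {P : A → Set ℓ} (P? : Decidable P) {m} (f : Fin m → A) →
    length (filter P? (List.tabulate f)) ≡ ℕΣ.sum λ i → [ P? (f i) ]₀₁
  length-filter-tabulate P? {zero}  f = refl
  length-filter-tabulate P? {suc m} f with does (P? (f zero))
  ... | true  = cong suc (length-filter-tabulate P? (f ∘ suc))
  ... | false = length-filter-tabulate P? (f ∘ suc)

  -- This is the count `h` as a sum of zeros and ones. In this form it loses its first position in
  -- the same way as `kᶜ`, and the predicate is arbitrary so that it can be restricted to later
  -- positions.
  countFrom : ∀ {ℓ m} {D : Fin m → Set ℓ} → (∀ j → Dec (D j)) → Fin (suc m) → ℕ
  countFrom D? i = ℕΣ.sum λ j → [ (toℕ i ℕₚ.≤? toℕ j) ×-dec D? j ]₀₁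

  countFrom-suc : ∀ {ℓ m} {D : Fin (suc m) → Set ℓ} (D? : ∀ j → Dec (D j)) i →
                  countFrom D? (suc i) ≡ countFrom (D? ∘ suc) i
  countFrom-suc D? i = ℕΣ.sum-cong-≗ λ j → cong (λ b → if b then 1 else 0) (does-⇔
    (mk⇔ (λ (i≤j , d) → ℕ.s≤s⁻¹ i≤j , d) (λ (i≤j , d) → s≤s i≤j , d))
    ((toℕ (suc i) ℕₚ.≤? toℕ (suc j)) ×-dec D? (suc j)) ((toℕ i ℕₚ.≤? toℕ j) ×-dec D? (suc j)))

  module _ {u v : ℕ} where

    admissible⇒consecutive : ∀ {m} {d : Fin m → ℕ} {e l} → Admissible u v d e l →
      (∀ i → Gap u (d i) (l (inject₁ i)) (l (suc i))) × Reach v e (l (fromℕ m))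
    admissible⇒consecutive {zero}  a       = (λ ()) , a
    admissible⇒consecutive {suc m} (g , a) with admissible⇒consecutive {m} a
    ... | gaps , last = (λ { zero → g ; (suc i) → gaps i }) , last

    consecutive⇒admissible : ∀ {m} {d : Fin m → ℕ} {e l} →
      (∀ i → Gap u (d i) (l (inject₁ i)) (l (suc i))) → Reach v e (l (fromℕ m)) → Admissible u v d e l
    consecutive⇒admissible {zero}  gaps last = last
    consecutive⇒admissible {suc m} gaps last = gaps zero , consecutive⇒admissible {m} (gaps ∘ suc) last

  -- In the application `j` is 1 at a descent and 0 elsewhere: a descent asks for one full multiple
  -- of `u` beyond the colour difference.
  reach⁺ : ∀ {u d j k z} → z ≡ d + k * u → j ≤ k → Reach u (u * j + d) z
  reach⁺ {u} {d} {j} {k} refl j≤k =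
    subst (u * j + d ≤_) (sym eq) (ℕₚ.m≤m+n (u * j + d) _) ,
    divides (k ∸ j) (trans (cong (_∸ (u * j + d)) eq) (ℕₚ.m+n∸m≡n (u * j + d) _))
    where
    eq : d + k * u ≡ u * j + d + (k ∸ j) * u
    eq = trans (cong (λ k → d + k * u) (sym (ℕₚ.m+[n∸m]≡n j≤k))) (rearrange d j (k ∸ j) u)
      where
      rearrange : ∀ d j k u → d + (j + k) * u ≡ u * j + d + k * u
      rearrange = solve-∀

  reach⁻ : ∀ {u d z} → Reach u d z → ∃ λ k → z ≡ d + k * u
  reach⁻ {u} {d} {z} (d≤z , divides k e) = k , trans (sym (ℕₚ.m+[n∸m]≡n d≤z)) (cong (d +_) e)

  sum-mod : ∀ {n r} {x y : Fin n → ℕ} e → (∀ i → x i ≡ y i + e [mod r ]) → ℕΣ.sum x ≡ ℕΣ.sum y + n * e [mod r ]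
  sum-mod {zero}  e x≡y = mod-refl
  sum-mod {suc n} {r} {x} {y} e x≡y = subst (λ z → ℕΣ.sum x ≡ z [mod r ])
    (rearrange (y zero) e (ℕΣ.sum (y ∘ suc)) (n * e)) (+-cong-mod (x≡y zero) (sum-mod e (x≡y ∘ suc)))
    where
    rearrange : ∀ a b c d → a + b + (c + d) ≡ a + c + (b + d)
    rearrange = solve-∀

  -- Colour differences and the gaps they force

  module _ {r : ℕ} .{{_ : NonZero r}} where

    colorDifference : Fin r → Fin r → ℕ
    colorDifference a b = R[ r ] (ℤ.+ toℕ a ℤ.- ℤ.+ toℕ b)

    colorDifference-< : ∀ a b → colorDifference a b ℕ.< r
    colorDifference-< a b = n%ℕd<d (ℤ.+ toℕ a ℤ.- ℤ.+ toℕ b) r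

    colorDifference-mod : ∀ a b → colorDifference a b + toℕ b ≡ toℕ a [mod r ]
    colorDifference-mod a b = go ((ℤ.+ toℕ a ℤ.- ℤ.+ toℕ b) /ℕ r) (a≡a%ℕn+[a/ℕn]*n (ℤ.+ toℕ a ℤ.- ℤ.+ toℕ b) r)
      where
      x = toℕ a
      y = toℕ b
      δ = colorDifference a b
      cancel : ∀ x y → x ℤ.- y ℤ.+ y ≡ x
      cancel = ℤSolver.solve-∀
      -- The sign of the integer quotient decides which side of the congruence receives the multiple
      -- of `r`.
      go : ∀ k → ℤ.+ x ℤ.- ℤ.+ y ≡ ℤ.+ δ ℤ.+ k ℤ.* ℤ.+ r → δ + y ≡ x [mod r ]
      go (ℤ.+ k) e = k , 0 , ℤₚ.+-injective (begin
        ℤ.+ (δ + y + k * r)                              ≡⟨ ℤₚ.pos-+ (δ + y) (k * r) ⟩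
        ℤ.+ (δ + y) ℤ.+ ℤ.+ (k * r)                      ≡⟨ cong₂ ℤ._+_ (ℤₚ.pos-+ δ y) (ℤₚ.pos-* k r) ⟩
        ℤ.+ δ ℤ.+ ℤ.+ y ℤ.+ ℤ.+ k ℤ.* ℤ.+ r              ≡⟨ move (ℤ.+ δ) (ℤ.+ y) (ℤ.+ k ℤ.* ℤ.+ r) ⟩
        (ℤ.+ δ ℤ.+ ℤ.+ k ℤ.* ℤ.+ r) ℤ.+ ℤ.+ y            ≡⟨ cong (ℤ._+ ℤ.+ y) e ⟨
        ℤ.+ x ℤ.- ℤ.+ y ℤ.+ ℤ.+ y                        ≡⟨ cancel (ℤ.+ x) (ℤ.+ y) ⟩
        ℤ.+ x                                            ≡⟨ cong ℤ.+_ (ℕₚ.+-identityʳ x) ⟨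
        ℤ.+ (x + 0)                                      ∎)
        where
        open ≡-Reasoning
        move : ∀ a b c → a ℤ.+ b ℤ.+ c ≡ a ℤ.+ c ℤ.+ b
        move = ℤSolver.solve-∀
      go ℤ.-[1+ k ] e = 0 , suc k , ℤₚ.+-injective (begin
        ℤ.+ (δ + y + 0)                                  ≡⟨ cong ℤ.+_ (ℕₚ.+-identityʳ (δ + y)) ⟩
        ℤ.+ (δ + y)                                      ≡⟨ ℤₚ.pos-+ δ y ⟩
        ℤ.+ δ ℤ.+ ℤ.+ y                                  ≡⟨ move (ℤ.+ δ) (ℤ.+ y) (ℤ.+ suc k) (ℤ.+ r) ⟩
        (ℤ.+ δ ℤ.+ (ℤ.- ℤ.+ suc k) ℤ.* ℤ.+ r) ℤ.+ ℤ.+ y ℤ.+ ℤ.+ suc k ℤ.* ℤ.+ r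
                                                         ≡⟨ cong (λ z → z ℤ.+ ℤ.+ y ℤ.+ ℤ.+ suc k ℤ.* ℤ.+ r) e ⟨
        ℤ.+ x ℤ.- ℤ.+ y ℤ.+ ℤ.+ y ℤ.+ ℤ.+ suc k ℤ.* ℤ.+ r
                                                         ≡⟨ cong₂ ℤ._+_ (cancel (ℤ.+ x) (ℤ.+ y)) (sym (ℤₚ.pos-* (suc k) r)) ⟩
        ℤ.+ x ℤ.+ ℤ.+ (suc k * r)                        ≡⟨ ℤₚ.pos-+ x (suc k * r) ⟨
        ℤ.+ (x + suc k * r)                              ∎)
        where
        open ≡-Reasoning
        move : ∀ a b k r → a ℤ.+ b ≡ (a ℤ.+ (ℤ.- k) ℤ.* r) ℤ.+ b ℤ.+ k ℤ.* r
        move = ℤSolver.solve-∀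

    mod⇒≡ : ∀ {x y} → x ≡ y [mod r ] → x ℕ.< r → y ℕ.< r → x ≡ y
    mod⇒≡ x≡y x<r y<r = trans (sym (m<n⇒m%n≡m x<r)) (trans (mod⇒% x≡y) (m<n⇒m%n≡m y<r))

    mod⇒color≡ : ∀ {a : Fin r} {x} → toℕ a ≡ x [mod r ] → x mod r ≡ a
    mod⇒color≡ {a} {x} a≡x = Finₚ.toℕ-injective
      (trans (toℕ-mod x) (trans (sym (mod⇒% a≡x)) (m<n⇒m%n≡m (Finₚ.toℕ<n a))))

    color≡⇒mod : ∀ {a : Fin r} {x} → x mod r ≡ a → toℕ a ≡ x [mod r ]
    color≡⇒mod {x = x} refl = subst (_≡ x [mod r ]) (sym (toℕ-mod x)) (mod-% x)

    module _ {a b : Fin r} {ℓ} {P : Set ℓ} (D? : Dec (a ≡ b × P)) where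

      private
        δ = colorDifference a b

      -- k is the shift, a multiple of r/s, relating the colours of a representative to the values x, y.
      gap⁺ : ∀ {x y} k → toℕ a ≡ x + k [mod r ] → toℕ b ≡ y + k [mod r ] → y ≤ x → (P → y ≢ x) →
             Gap r (r * [ D? ]₀₁ + δ) x y
      gap⁺ {x} {y} k a≡ b≡ y≤x P⇒y≢x = y≤x , reach⁺ z≡ (enough D?)
        where
        z = x ∸ y
        δ≡z : δ ≡ z [mod r ]
        δ≡z = mod-cancelʳ (y + k) (mod-trans (+-cong-mod (mod-refl {a = δ}) (mod-sym b≡))
          (mod-trans (colorDifference-mod a b) (subst (λ w → toℕ a ≡ w [mod r ])
            (trans (cong (_+ k) (sym (ℕₚ.m∸n+n≡m y≤x))) (ℕₚ.+-assoc z y k)) a≡)))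
        z≡ : z ≡ δ + z / r * r
        z≡ = trans (m≡m%n+[m/n]*n z r) (cong (_+ z / r * r)
          (trans (sym (mod⇒% δ≡z)) (m<n⇒m%n≡m (colorDifference-< a b))))
        -- At a descent the colours agree and δ is 0. A zero quotient would then make the values
        -- equal, which `P⇒y≢x` forbids.
        enough : (D? : Dec (a ≡ b × P)) → [ D? ]₀₁ ≤ z / r
        enough (no _)            = z≤n
        enough (yes (a≡b , p)) with z / r in eq
        ... | suc _ = s≤s z≤n
        ... | zero  = contradiction (ℕₚ.≤-antisym y≤x (ℕₚ.m∸n≡0⇒m≤n z≡0)) (P⇒y≢x p)
          where
          δ≡0 : δ ≡ 0
          δ≡0 = mod⇒≡ (mod-cancelʳ (toℕ b) (subst (λ c → δ + toℕ b ≡ toℕ c [mod r ]) a≡b (colorDifference-mod a b)))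
            (colorDifference-< a b) (ℕ.>-nonZero⁻¹ r)
          z≡0 : z ≡ 0
          z≡0 = trans z≡ (cong₂ (λ i j → i + j * r) δ≡0 eq)

      -- Modulo `r` a gap is the difference of the colours, so a congruence known at one position
      -- passes to the position before it.
      gap⁻-shift : ∀ {x y} k → Gap r (r * [ D? ]₀₁ + δ) x y → toℕ b ≡ y + k [mod r ] → toℕ a ≡ x + k [mod r ]
      gap⁻-shift {x} {y} k (y≤x , reach) b≡ with reach⁻ reach
      ... | j , z≡ = mod-trans (mod-sym (colorDifference-mod a b)) (mod-trans (+-cong-mod (mod-refl {a = δ}) b≡)
        (mod-sym (subst (_≡ δ + (y + k) [mod r ]) (sym x≡) (mod-multiple (δ + (y + k)) ([ D? ]₀₁ + j)))))
        where
        rearrange : ∀ r i δ j y k → r * i + δ + j * r + y + k ≡ δ + (y + k) + (i + j) * r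
        rearrange = solve-∀
        x≡ : x + k ≡ δ + (y + k) + ([ D? ]₀₁ + j) * r
        x≡ = trans (cong (_+ k) (trans (sym (ℕₚ.m∸n+n≡m y≤x)) (cong (_+ y) z≡))) (rearrange r [ D? ]₀₁ δ j y k)

      -- A gap of zero leaves room neither for the colour difference nor for an extra `r`. So the
      -- colours agree, and `P` would make the position a descent, which costs `r`.
      gap⁻-tie : ∀ {x} → Gap r (r * [ D? ]₀₁ + δ) x x → ¬ P
      gap⁻-tie {x} (_ , d≤0 , _) p = excluded D? (ℕₚ.n≤0⇒n≡0 (subst (r * [ D? ]₀₁ + δ ≤_) (ℕₚ.n∸n≡0 x) d≤0))
        where
        excluded : (D? : Dec (a ≡ b × P)) → r * [ D? ]₀₁ + δ ≡ 0 → ⊥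
        excluded (yes _) e = ℕ.≢-nonZero⁻¹ r (trans (sym (ℕₚ.*-identityʳ r)) (ℕₚ.m+n≡0⇒m≡0 (r * 1) e))
        excluded (no ¬d) e = ¬d (a≡b , p)
          where
          a≡b : a ≡ b
          a≡b = sym (Finₚ.toℕ-injective (mod⇒≡
            (subst (λ d → d + toℕ b ≡ toℕ a [mod r ]) (ℕₚ.m+n≡0⇒n≡0 (r * 0) e) (colorDifference-mod a b))
            (Finₚ.toℕ<n b) (Finₚ.toℕ<n a)))

  -- Functions and the classes of coloured permutations they determine

  module Standardization (r p : ℕ) {s : ℕ} (s∣r : s ∣ r) (m : ℕ) .{{r≢0 : NonZero r}} where

    private
      n = suc m
      w = quotient s∣r
      G = G⟨r,p,n⟩ r p s∣r n
      instance
        w≢0 : NonZero w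
        w≢0 = quotient≢0 s∣r
      w∣r : w ∣ r
      w∣r = quotient-∣ s∣r

    open Cosets G⟨ r , n ⟩ (γ s∣r n) using (_∼_)
    open RawMonoidDefs (Group.rawMonoid G⟨ r , n ⟩) using () renaming (_×_ to pow)

    gaps : G → Fin m → ℕ
    gaps g i = r * [ HDes? s∣r g i ]₀₁ + colorDifference (color (proj₁ g) (inject₁ i)) (color (proj₁ g) (suc i))

    base : G → ℕ
    base g = toℕ (color (proj₁ g) (fromℕ m)) % w

    λ′-partSizes : ∀ g → λ′ s∣r g ≗ partSizes (gaps g) (base g)
    λ′-partSizes g i = trans
      (cong (λ h → r * h + k s∣r g i) (length-filter-tabulate (λ j → (toℕ i ℕₚ.≤? toℕ j) ×-dec HDes? s∣r g j) id))
      (go (color (proj₁ g)) (HDes? s∣r g) i)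
      where
      -- Dropping a position does not yield an element of the group, so the induction is on
      -- arbitrary colours and an arbitrary decidable predicate.
      go : ∀ {ℓ m′} (c : Fin (suc m′) → Fin r) {D : Fin m′ → Set ℓ} (D? : ∀ j → Dec (D j)) i →
           r * countFrom D? i + kᶜ {p = p} s∣r {m} c i
             ≡ partSizes (λ j → r * [ D? j ]₀₁ + colorDifference (c (inject₁ j)) (c (suc j))) (toℕ (c (fromℕ m′)) % w) i
      go {m′ = zero} c D? zero = cong (_+ toℕ (c zero) % w) (ℕₚ.*-zeroʳ r)
      go {m′ = suc m′} c D? (suc i) = trans
        (cong (λ h → r * h + kᶜ {p = p} s∣r {m} (c ∘ suc) i) (countFrom-suc D? i)) (go (c ∘ suc) (D? ∘ suc) i)
      go {m′ = suc m′} c D? zero = trans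
        (rearrange r [ D? zero ]₀₁ (countFrom (D? ∘ suc) zero) _ _)
        (cong (r * [ D? zero ]₀₁ + colorDifference (c zero) (c (suc zero)) +_) (go (c ∘ suc) (D? ∘ suc) zero))
        where
        rearrange : ∀ r i h k d → r * (i + h) + (k + d) ≡ r * i + d + (r * h + k)
        rearrange = solve-∀

    fdes-partSizes : ∀ g → fdes s∣r g ≡ partSizes (gaps g) (base g) zero
    fdes-partSizes g = λ′-partSizes g zero

    fmaj-partSizes : ∀ g → fmaj s∣r g ≡ ℕΣ.sum (partSizes (gaps g) (base g))
    fmaj-partSizes g = ℕΣ.sum-cong-≗ (λ′-partSizes g)

    color-pow : ∀ k i → color (pow k (γ s∣r n)) i ≡ (k * w) mod r
    color-pow zero    i = refl
    color-pow (suc k) i = trans (⊕-comm (color (pow k (γ s∣r n)) i) (w mod r))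
      (trans (cong ((w mod r) ⊕_) (color-pow k i)) (mod-+ w (k * w)))

    perm-pow : ∀ k i → perm (pow k (γ s∣r n)) ⟨$⟩ʳ i ≡ i
    perm-pow zero    i = refl
    perm-pow (suc k) i = perm-pow k i

    ∼⁺ : ∀ {x y : ColoredPermutation r n} k → (∀ i → color y i ≡ (toℕ (color x i) + k * w) mod r) →
         perm x Perm.≈ perm y → x ∼ y
    ∼⁺ {x} {y} k c σ = k , (λ i → trans (cong (color x i ⊕_) (color-pow k (perm x ⟨$⟩ʳ i)))
        (trans (cong (_⊕ ((k * w) mod r)) (sym (mod-toℕ (color x i)))) (trans (mod-+ (toℕ (color x i)) (k * w)) (sym (c i)))))
      , (λ i → trans (perm-pow k (perm x ⟨$⟩ʳ i)) (σ i))

    ∼⁻ : ∀ {x y : ColoredPermutation r n} → x ∼ y → ∃ λ k →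
         (∀ i → color y i ≡ (toℕ (color x i) + k * w) mod r) × perm x Perm.≈ perm y
    ∼⁻ {x} {y} (k , c , σ) = k ,
      (λ i → trans (sym (c i)) (trans (cong (color x i ⊕_) (color-pow k (perm x ⟨$⟩ʳ i)))
        (trans (cong (_⊕ ((k * w) mod r)) (sym (mod-toℕ (color x i)))) (mod-+ (toℕ (color x i)) (k * w))))) ,
      (λ i → trans (sym (perm-pow k (perm x ⟨$⟩ʳ i))) (σ i))

    module _ (f : Fin n → ℕ) where
      open IsStrictTotalOrder (≺-isStrictTotalOrder f) renaming (trans to ≺-trans; irrefl to ≺-irrefl) using ()
      open Sorting (≺-isStrictTotalOrder f)

      standard : ColoredPermutation r n
      standard = ⟨ (λ i → f (sorting ⟨$⟩ʳ i) mod r) ︔ sorting ⟩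

      -- Up to a power of γ, the colours of x are the residues of the sorted values of f.
      record Standardizes (x : ColoredPermutation r n) : Set where
        field
          shift  : ℕ
          colors : ∀ i → toℕ (color x i) ≡ f (perm x ⟨$⟩ʳ i) + shift * w [mod r ]
          sorted : ∀ i → f ⊢ (perm x ⟨$⟩ʳ inject₁ i) ≺ (perm x ⟨$⟩ʳ suc i)

      standard-standardizes : Standardizes standard
      standard-standardizes = record
        { shift  = 0
        ; colors = λ i → subst (toℕ (color standard i) ≡_[mod r ]) (sym (ℕₚ.+-identityʳ _)) (color≡⇒mod refl)
        ; sorted = λ i → sorting-sorts (ℕₚ.≤-reflexive (cong suc (Finₚ.toℕ-inject₁ i)))
        }

      -- The order determines its sorting permutation, so only the common shift of the colours is
      -- free; it is the exponent of the generator.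
      standardizes⇒∼ : ∀ {x} → Standardizes x → standard ∼ x
      standardizes⇒∼ {x} std = ∼⁺ {standard} {x} shift
        (λ i → sym (mod⇒color≡ (mod-trans (colors i)
          (subst (λ j → f j + shift * w ≡ toℕ (color standard i) + shift * w [mod r ]) (σ≈ i)
          (+-cong-mod (mod-sym (color≡⇒mod {a = color standard i} refl)) mod-refl)))))
        σ≈
        where
        open Standardizes std
        σ≈ : ∀ i → sorting ⟨$⟩ʳ i ≡ perm x ⟨$⟩ʳ i
        σ≈ = sorts-unique sorting (perm x) sorting-sorts
          (consecutive⇒monotone {_≺_ = f ⊢_≺_} ≺-trans {x = perm x ⟨$⟩ʳ_} sorted)

      ∼⇒standardizes : ∀ {x} → standard ∼ x → Standardizes x
      ∼⇒standardizes {x} std∼x = record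
        { shift  = proj₁ unpacked
        ; colors = λ i → mod-trans (color≡⇒mod (sym (proj₁ (proj₂ unpacked) i)))
            (subst (λ j → toℕ (color standard i) + proj₁ unpacked * w ≡ f j + proj₁ unpacked * w [mod r ]) (σ i)
              (+-cong-mod (color≡⇒mod {a = color standard i} refl) mod-refl))
        ; sorted = λ i → subst₂ (f ⊢_≺_) (σ (inject₁ i)) (σ (suc i)) (Standardizes.sorted standard-standardizes i)
        }
        where
        unpacked = ∼⁻ {standard} {x} std∼x
        σ = proj₂ (proj₂ unpacked)

      standardizes⇒admissible : ∀ g → Standardizes (proj₁ g) → Admissible r w (gaps g) (base g) (f ∘ (perm (proj₁ g) ⟨$⟩ʳ_))
      standardizes⇒admissible g@(x , _) std = consecutive⇒admissible step (last-≤ , last-∣)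
        where
        open Standardizes std
        l = f ∘ (perm x ⟨$⟩ʳ_)
        step : ∀ i → Gap r (gaps g i) (l (inject₁ i)) (l (suc i))
        -- At equal values a descent of the permutation would put the two positions in the opposite
        -- order of the tie-breaking.
        step i = gap⁺ (HDes? s∣r g i) (shift * w) (colors (inject₁ i)) (colors (suc i)) (decreasing (sorted i)) λ σ> e →
          ≺-irrefl refl (≺-trans (sorted i) (inj₂ (e , σ>)))
          where
          decreasing : f ⊢ (perm x ⟨$⟩ʳ inject₁ i) ≺ (perm x ⟨$⟩ʳ suc i) → l (suc i) ≤ l (inject₁ i)
          decreasing (inj₁ l>)      = ℕₚ.<⇒≤ l>
          decreasing (inj₂ (e , _)) = ℕₚ.≤-reflexive (sym e)
        lₙ = l (fromℕ m)
        -- The shift is a multiple of `w`, so it vanishes modulo `w`, though in general not modulo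
        -- `r`.
        base≡ : base g ≡ lₙ % w
        base≡ = mod⇒% (mod-trans (mod-weaken w∣r (colors (fromℕ m))) (mod-multiple lₙ shift))
        last-≤ : base g ≤ lₙ
        last-≤ = subst (_≤ lₙ) (sym base≡) (m%n≤m lₙ w)
        last-∣ : w ∣ lₙ ∸ base g
        last-∣ = divides (lₙ / w) (trans (cong₂ _∸_ (m≡m%n+[m/n]*n lₙ w) base≡) (ℕₚ.m+n∸m≡n (lₙ % w) _))

      admissible⇒standardizes : ∀ g → Admissible r w (gaps g) (base g) (f ∘ (perm (proj₁ g) ⟨$⟩ʳ_)) → Standardizes (proj₁ g)
      admissible⇒standardizes g@(x , _) adm with admissible⇒consecutive adm
      ... | step , last with reach⁻ last
      ... | b , lₙ≡ = record { shift = κ ; colors = descend m c l {D? = HDes? s∣r g} step colorₙ ; sorted = sorted }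
        where
        l = f ∘ (perm x ⟨$⟩ʳ_)
        c = color x
        cₙ = toℕ (c (fromℕ m))
        -- With `lₙ = cₙ % w + b * w`, the required shift is `cₙ / w - b`. Modulo `r` the term
        -- `-b * w` may be replaced by `b * (r - 1) * w`, which avoids negative numbers.
        κ = cₙ / w + b * ℕ.pred r
        colorₙ : cₙ ≡ l (fromℕ m) + κ * w [mod r ]
        colorₙ = mod-sym (subst (_≡ cₙ [mod r ]) (sym total) (mod-multiple cₙ (b * w)))
          where
          open ≡-Reasoning
          rearrange : ∀ a b j q w → a + b * w + (j + b * q) * w ≡ a + j * w + b * w * suc q
          rearrange = solve-∀
          total : l (fromℕ m) + κ * w ≡ cₙ + b * w * r
          total = begin
            l (fromℕ m) + κ * w                             ≡⟨ cong (_+ κ * w) lₙ≡ ⟩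
            cₙ % w + b * w + κ * w                          ≡⟨ rearrange (cₙ % w) b (cₙ / w) (ℕ.pred r) w ⟩
            cₙ % w + cₙ / w * w + b * w * suc (ℕ.pred r)    ≡⟨ cong₂ (λ y z → y + b * w * z) (sym (m≡m%n+[m/n]*n cₙ w)) (ℕₚ.suc-pred r) ⟩
            cₙ + b * w * r                                  ∎
        -- Only the colour of the last position is compared with its value directly; the others
        -- follow backwards through the gaps.
        descend : ∀ m′ (c : Fin (suc m′) → Fin r) (l : Fin (suc m′) → ℕ) {ℓ} {P : Fin m′ → Set ℓ}
          {D? : ∀ i → Dec (c (inject₁ i) ≡ c (suc i) × P i)} →
          (∀ i → Gap r (r * [ D? i ]₀₁ + colorDifference (c (inject₁ i)) (c (suc i))) (l (inject₁ i)) (l (suc i))) →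
          toℕ (c (fromℕ m′)) ≡ l (fromℕ m′) + κ * w [mod r ] → ∀ i → toℕ (c i) ≡ l i + κ * w [mod r ]
        descend zero     c l gap last zero    = last
        descend (suc m′) c l {D? = D?} gap last (suc i) = descend m′ (c ∘ suc) (l ∘ suc) {D? = D? ∘ suc} (gap ∘ suc) last i
        descend (suc m′) c l {D? = D?} gap last zero    =
          gap⁻-shift (D? zero) (κ * w) (gap zero) (descend m′ (c ∘ suc) (l ∘ suc) {D? = D? ∘ suc} (gap ∘ suc) last zero)
        sorted : ∀ i → f ⊢ (perm x ⟨$⟩ʳ inject₁ i) ≺ (perm x ⟨$⟩ʳ suc i)
        sorted i with ℕₚ.<-cmp (l (inject₁ i)) (l (suc i))
        ... | tri> _ _ l> = inj₁ l>
        ... | tri< l< _ _ = contradiction (proj₁ (step i)) (ℕₚ.<⇒≱ l<)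
        ... | tri≈ _ l≡ _ with Finₚ.<-cmp (perm x ⟨$⟩ʳ inject₁ i) (perm x ⟨$⟩ʳ suc i)
        ...   | tri< σ< _ _ = inj₂ (l≡ , σ<)
        ...   | tri≈ _ σ≡ _ = contradiction
          (trans (sym (Finₚ.toℕ-inject₁ i)) (cong toℕ
            (trans (sym (inverseˡ (perm x))) (trans (cong (perm x ⟨$⟩ˡ_) σ≡) (inverseˡ (perm x))))))
          (ℕₚ.<⇒≢ (ℕₚ.n<1+n (toℕ i)))
        ...   | tri> _ _ σ> = contradiction σ>
          (gap⁻-tie (HDes? s∣r g i) (subst (λ z → Gap r (gaps g i) z (l (suc i))) l≡ (step i)))

      admissible⇔∼ : ∀ g → Admissible r w (gaps g) (base g) (f ∘ (perm (proj₁ g) ⟨$⟩ʳ_)) ⇔ standard ∼ proj₁ g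
      admissible⇔∼ g = mk⇔ (λ a → standardizes⇒∼ {proj₁ g} (admissible⇒standardizes g a))
        (λ e → standardizes⇒admissible g (∼⇒standardizes {proj₁ g} e))

      colorSum-mod : ∀ {x} (std : Standardizes x) →
        colorSum x ≡ ℕΣ.sum f + n * (Standardizes.shift std * w) [mod r ]
      colorSum-mod {x} std = subst (λ z → colorSum x ≡ z + n * (shift * w) [mod r ]) (sym (ℕΣ.sum-permute f (perm x)))
        (sum-mod (shift * w) colors)
        where open Standardizes std

      module _ .{{_ : NonZero s}} (p∣r : p ∣ r) (ps∣rn : p * s ∣ r * n) where

        -- Since `r = w * s`, cancelling `s` in `p * s ∣ r * n` leaves `p ∣ n * w`. Shifting all `n`
        -- colours by a multiple of `w` thus keeps their sum unchanged modulo `p`.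
        p∣n*kw : ∀ k → p ∣ n * (k * w)
        p∣n*kw k = subst (p ∣_) (rearrange k n w) (∣n⇒∣m*n k (*-cancelʳ-∣ s
          (subst (p * s ∣_) (trans (cong (_* n) (m∣n⇒n≡quotient*m s∣r)) (exchange w s n)) ps∣rn)))
          where
          rearrange : ∀ k n w → k * (n * w) ≡ n * (k * w)
          rearrange = solve-∀
          exchange : ∀ w s n → w * s * n ≡ n * w * s
          exchange = solve-∀

        ∣colorSum⁺ : ∀ {x} → Standardizes x → p ∣ ℕΣ.sum f → p ∣ colorSum x
        ∣colorSum⁺ std p∣f = mod-∣ p∣r (mod-sym (colorSum-mod std)) (∣m∣n⇒∣m+n p∣f (p∣n*kw (Standardizes.shift std)))

        ∣colorSum⁻ : ∀ {x} → Standardizes x → p ∣ colorSum x → p ∣ ℕΣ.sum f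
        ∣colorSum⁻ std p∣x = ∣m+n∣m⇒∣n
          (subst (p ∣_) (ℕₚ.+-comm (ℕΣ.sum f) _) (mod-∣ p∣r (colorSum-mod std) p∣x)) (p∣n*kw (Standardizes.shift std))

-- Distributing the functions of a box over the classes

module Counting (r p : ℕ) {s : ℕ} (s∣r : s ∣ r) (m : ℕ) .{{_ : NonZero r}} .{{_ : NonZero s}}
  (p∣r : p ∣ r) (ps∣rn : p ℕ.* s ∣ r ℕ.* suc m)
  (gs : List (G⟨r,p,n⟩ r p s∣r (suc m)))
  (enumerates : IsEnumeration (G⟨r,p,s,n⟩ r p s∣r (suc m)) gs)
  (unique : Unique (G⟨r,p,s,n⟩ r p s∣r (suc m)) gs) where

  open Combinatorics.Standardization r p s∣r m
  open ColoredPermutation using (perm)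

  private
    n = suc m
    w = quotient s∣r
    G = G⟨r,p,n⟩ r p s∣r n
    instance
      w≢0 : NonZero w
      w≢0 = quotient≢0 s∣r

  open CommutativeRing ℤ⟦q⟧ᶜ hiding (zero)
  open SemiringSum semiring using (sum)
  open Indicator ℤ⟦q⟧ᶜ
  open FunctionSums ℤ⟦q⟧ᶜ
  open AdmissibleSums ℤ⟦q⟧ᶜ q₁
  open ListSums ℤ⟦q⟧ᶜ
  open GapSeries ℤ⟦q⟧ᶜ q₁ using (X; module Gaps)
  open Gaps r w using (gapSeries)
  open ℤ⟦q⟧ using (∑-list)
  open SetoidReasoning setoid

  module _ (f : Fin n → ℕ) where

    sortedBy? : ∀ g → Dec (Admissible r w (gaps g) (base g) (f ∘ (perm (proj₁ g) ⟨$⟩ʳ_)))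
    sortedBy? g = admissible? r w (gaps g) (base g) (f ∘ (perm (proj₁ g) ⟨$⟩ʳ_))

    -- If p divides |f|, the standard coloured permutation lies in G(r,p,n), so the list meets its
    -- class, and two admissible members would be equivalent. Otherwise an admissible member would
    -- have a colour sum that p does not divide.
    exactly-one : ∑-list gs (𝟙 ∘ sortedBy?) ≈ 𝟙 (p ∣? ℕΣ.sum f)
    exactly-one with p ∣? ℕΣ.sum f
    ... | no ¬p∣f = ∑-𝟙-none sortedBy? (All.universal
      (λ g a → ¬p∣f (∣colorSum⁻ f p∣r ps∣rn {proj₁ g} (admissible⇒standardizes f g a) (proj₂ g))) gs)
    ... | yes p∣f = ∑-𝟙-one sortedBy?
      (AllPairs.map (λ {g} {h} g≁h (a , b) → g≁h (Classes.trans {g} {f₀} {h}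
        (Classes.sym {f₀} {g} (Equivalence.to (admissible⇔∼ f g) a)) (Equivalence.to (admissible⇔∼ f h) b))) unique)
      (Any.map (λ {g} → Equivalence.from (admissible⇔∼ f g)) (enumerates f₀))
      where
      module Classes = Setoid (G⟨r,p,s,n⟩ r p s∣r n)
      f₀ : G
      f₀ = standard f , ∣colorSum⁺ f p∣r ps∣rn {standard f} (standard-standardizes f) p∣f

  coefficient : ∀ K → keep p ((ℤ⟦q⟧.[ suc K ] q₁) ℤ⟦q⟧.^ n) ≈
                ∑-list gs λ g → (gapSeries (gaps g) (base g) ℤ⟦q⟧⟦t⟧.* X 1 0) K
  coefficient K = begin
    keep p ((ℤ⟦q⟧.[ N ] q₁) ℤ⟦q⟧.^ n)
      ≈⟨ keep-cong p (box n N) ⟩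
    keep p (∑ᶠ n N monomial)
      ≈⟨ keep-sum p (N ℕ.^ n) _ ⟩
    ∑ᶠ n N (λ f → keep p (monomial f))
      ≈⟨ ∑ᶠ-cong n N (λ f → keep-q^ p (size f)) ⟩
    ∑ᶠ n N (λ f → 𝟙 (p ∣? size f) * monomial f)
      ≈⟨ ∑ᶠ-cong n N (λ f → *-congʳ {monomial f} (sym (exactly-one (toℕ ∘ f)))) ⟩
    ∑ᶠ n N (λ f → ∑-list gs (𝟙 ∘ sortedBy? (toℕ ∘ f)) * monomial f)
      ≈⟨ ∑ᶠ-cong n N (λ f → trans (∑-list-*ʳ gs (𝟙 ∘ sortedBy? (toℕ ∘ f)) (monomial f))
           (∑-list-cong gs (λ g → *-congˡ {𝟙 (sortedBy? (toℕ ∘ f) g)} (monomial-permute f (perm (proj₁ g)))))) ⟩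
    ∑ᶠ n N (λ f → ∑-list gs λ g → permuted g f)
      ≈⟨ ∑-list-swap gs (N ℕ.^ n) _ ⟩
    ∑-list gs (λ g → ∑ᶠ n N (permuted g))
      -- Precomposition with the permutation of `g` permutes the box, so each class can be summed
      -- over its own sorted sequences, with no permutation left in the summand.
      ≈⟨ ∑-list-cong gs (λ g → trans
           (sym (∑ᶠ-permute n N (weight r w (gaps g) (base g)) (weight-cong r w (gaps g) (base g)) (perm (proj₁ g))))
           (weight-sum r w K (gaps g) (base g))) ⟩
    ∑-list gs (λ g → (gapSeries (gaps g) (base g) ℤ⟦q⟧⟦t⟧.* X 1 0) K) ∎
    where
    N = suc K
    permuted : G → (Fin n → Fin N) → Carrier
    permuted g f = weight r w (gaps g) (base g) (f ∘ (perm (proj₁ g) ⟨$⟩ʳ_))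
    monomial-permute : ∀ f π → monomial f ≈ monomial {n} {N} (f ∘ (π ⟨$⟩ʳ_))
    monomial-permute f π = reflexive (≡.cong (q₁ ℤ⟦q⟧.^_) (ℕΣ.sum-permute (toℕ ∘ f) π))

-- Assembling the quotient from the contributions of the classes

open ℤ⟦q⟧⟦t⟧

theorem5p5 :
    ∀ (r p s m : ℕ) .{{_ : NonZero r}} .{{_ : NonZero p}} .{{_ : NonZero s}} →
    let n = suc m in
    p ∣ r → (s∣r : s ∣ r) → p ℕ.* s ∣ r ℕ.* n →
    let r/s = quotient s∣r in
    (gs : List (G⟨r,p,n⟩ r p s∣r n)) →
    IsEnumeration (G⟨r,p,s,n⟩ r p s∣r n) gs → Unique (G⟨r,p,s,n⟩ r p s∣r n) gs →
    ❴ ∑tᵏ (λ k → (ℤ⟦q⟧.[ suc k ] q₁) ℤ⟦q⟧.^ n) ❵q^ p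
      ≈ ∑[ g ∈ gs ] (t ^ fdes s∣r g * q ^ fmaj s∣r g)
      / ((1# - t) * ∏[i< m ] (λ i → 1# - t ^ r * q ^ (suc i ℕ.* r))
                  * (1# - t ^ r/s * q ^ (n ℕ.* r/s)))
theorem5p5 r p s m p∣r s∣r ps∣rn gs enumerates unique =
  -- The factor `1 - t` is inverted by `X 1 0` and the rest of the denominator by `D⁻¹`. They stay
  -- separate because the closed form of a class involves only `denominator m`.
  X 1 0 * D⁻¹ ,
  *-inverses (1# - t) (X 1 0) (∏[i< m ] (λ i → 1# - t ^ r * q ^ (suc i ℕ.* r)))
    (1# - t ^ w * q ^ (suc m ℕ.* w)) D⁻¹ geometric₁ D*D⁻¹ ,
  numerator
  where
  w = quotient s∣r
  instance
    w≢0 : NonZero w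
    w≢0 = quotient≢0 s∣r
  module 𝔹 = CommutativeRing ℤ⟦q⟧⟦t⟧ᶜ
  open Combinatorics.Standardization r p s∣r m
  open GapSeries ℤ⟦q⟧ᶜ q₁ using (X; geometric₀; module Gaps)
  open Gaps r w using (gapSeries; gapSeries-closed; denominator; denominator-unit)
  open Quotients ℤ⟦q⟧⟦t⟧ᶜ
  open ListSums ℤ⟦q⟧⟦t⟧ᶜ
  open Counting r p s∣r m p∣r ps∣rn gs enumerates unique using (coefficient)
  open SetoidReasoning 𝔹.setoid

  D⁻¹ : Carrier
  D⁻¹ = proj₁ (denominator-unit m)
  D*D⁻¹ : denominator m * D⁻¹ ≈ 1#
  D*D⁻¹ = proj₂ (denominator-unit m)

  geometric₁ : (1# - t) * X 1 0 ≈ 1#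
  geometric₁ = begin
    (1# - t) * X 1 0        ≈⟨ 𝔹.*-congʳ {X 1 0} {1# - t} {1# - t ^ 1} (𝔹.+-congˡ {1#} {𝔹.- t} {𝔹.- (t ^ 1)}
                                (𝔹.-‿cong {t} {t ^ 1} (𝔹.sym {t ^ 1} {t} (𝔹.*-identityʳ t)))) ⟩
    (1# - t ^ 1) * X 1 0    ≈⟨ geometric₀ 1 ⟩
    1#                      ∎

  series : G⟨r,p,n⟩ r p s∣r (suc m) → Carrier
  series g = gapSeries (gaps g) (base g)

  monomial≈ : ∀ g → series g * denominator m ≈ t ^ fdes s∣r g * q ^ fmaj s∣r g
  monomial≈ g = ≡.subst₂ (λ a b → series g * denominator m ≈ t ^ a * q ^ b)
    (≡.sym (fdes-partSizes g)) (≡.sym (fmaj-partSizes g)) (gapSeries-closed (gaps g) (base g))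

  numerator : ❴ ∑tᵏ (λ k → (ℤ⟦q⟧.[ suc k ] q₁) ℤ⟦q⟧.^ suc m) ❵q^ p
              ≈ ∑[ g ∈ gs ] (t ^ fdes s∣r g * q ^ fmaj s∣r g) * (X 1 0 * D⁻¹)
  numerator = begin
    ❴ ∑tᵏ (λ k → (ℤ⟦q⟧.[ suc k ] q₁) ℤ⟦q⟧.^ suc m) ❵q^ p
      ≈⟨ (λ K j → ≡.trans (coefficient K j)
           (≡.cong (λ F → F j) (≡.sym (∑-list-coefficient gs (λ g → series g * X 1 0) K)))) ⟩
    ∑[ g ∈ gs ] (series g * X 1 0)
      ≈⟨ ∑-list-cong gs (λ g → *-split {series g} {denominator m} (X 1 0) (monomial≈ g) D*D⁻¹) ⟩
    ∑[ g ∈ gs ] (t ^ fdes s∣r g * q ^ fmaj s∣r g * (X 1 0 * D⁻¹))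
      ≈⟨ ∑-list-*ʳ gs (λ g → t ^ fdes s∣r g * q ^ fmaj s∣r g) (X 1 0 * D⁻¹) ⟨
    (∑[ g ∈ gs ] (t ^ fdes s∣r g * q ^ fmaj s∣r g)) * (X 1 0 * D⁻¹) ∎
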